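{- For every integer $n\geq 0$, $$\sum_{k=0}^{n}\binom{n}{k}(1+y)^{k}(1-t)^{n-k}A_{k}(t)=(1+yt)^{n}P_{n}^{(\mathrm{lpk},\mathrm{des})}\left(\frac{(1+y)^{2}t}{(y+t)(1+yt)},\frac{y+t}{1+yt}\right).$$ Equivalently, $$P_{n}^{(\mathrm{lpk},\mathrm{des})}(y,t)=\frac{1}{(1+uv)^{n}}\sum_{k=0}^{n}\binom{n}{k}(1+u)^{k}(1-v)^{n-k}A_{k}(v),$$ where $$u=\frac{1+t^{2}-2yt-(1-t)\sqrt{(1+t)^{2}-4yt}}{2(1-y)t},\qquad v=\frac{(1+t)^{2}-2yt-(1+t)\sqrt{(1+t)^{2}-4yt}}{2yt}.$$
   Context: $\mathfrak{S}_n$ is the set of permutations $\pi=\pi_1\cdots\pi_n$ of $[n]=\{1,\dots,n\}$. For $\pi\in\mathfrak{S}_n$: $\mathrm{des}(\pi)$ is the number of descents, i.e. of $i\in[n-1]$ with $\pi_i>\pi_{i+1}$; $\mathrm{lpk}(\pi)$ is the number of left peaks, where $i\in[n-1]$ is a left peak if either $2\le i\le n-1$ and $\pi_{i-1}<\pi_i>\pi_{i+1}$, or $i=1$ and $\pi_1>\pi_2$. The Eulerian polynomials are $A_n(t)=\sum_{\pi\in\mathfrak{S}_n}t^{\mathrm{des}(\pi)+1}$ for $n\ge1$ and $A_0(t)=1$. For $n\ge1$, $P_n^{(\mathrm{lpk},\mathrm{des})}(y,t)=\sum_{\pi\in\mathfrak{S}_n}y^{\mathrm{lpk}(\pi)}t^{\mathrm{des}(\pi)}$,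 and $P_0^{(\mathrm{lpk},\mathrm{des})}=1$. Here $y,t$ are indeterminates; the first identity is an identity of rational functions in $y,t$. In the second identity, $\sqrt{(1+t)^2-4yt}$ is the formal power series in $t$ over $\mathbb{Q}[y]$ with constant term $1$, so that $u$ and $v$ are formal power series in $t$ with coefficients in $\mathbb{Q}[y]$. -}

module Defs where

open import Algebra.Bundles using (CommutativeRing; RawRing)
open import Algebra.Morphism.Structures using (IsRingMonomorphism)
import Algebra.Morphism.RingMonomorphism as RingMonomorphism
import Algebra.Properties.CommutativeSemiring.Exp as Exp
import Algebra.Properties.Ring as RingProperties
import Algebra.Properties.Semiring.Mult as Mult
import Algebra.Properties.Semiring.Sum as Sum
import Algebra.Solver.Ring.NaturalCoefficients.Default as Solver
open import Data.Bool.Base using (if_then_else_)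
open import Data.Fin.Base using (toℕ)
open import Data.List.Base using (List; []; _∷_; _++_; map; concatMap; foldr; filter; applyDownFrom)
open import Data.List.Membership.Propositional using (_∈_; _∉_; find)
open import Data.List.Membership.Propositional.Properties
  using (∈-map⁺; ∈-map⁻; ∈-concatMap⁺; ∈-concatMap⁻; ∈-∃++)
open import Data.List.Properties using (∷-injectiveˡ; ∷-injectiveʳ; filter-all; filter-accept; filter-reject)
open import Data.List.Relation.Binary.Disjoint.Propositional using (Disjoint)
open import Data.List.Relation.Binary.Permutation.Propositional
  using (_↭_; ↭-refl; ↭-sym; ↭-trans; prep; swap)
open import Data.List.Relation.Binary.Permutation.Propositional.Properties
  using (drop-mid; ∈-resp-↭; ↭-empty-inv)
open import Data.List.Relation.Unary.All as All using (All; []; _∷_)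
import Data.List.Relation.Unary.All.Properties as All
open import Data.List.Relation.Unary.AllPairs as AllPairs using (AllPairs; []; _∷_)
import Data.List.Relation.Unary.AllPairs.Properties as AllPairs
open import Data.List.Relation.Unary.Any as Any using (here; there)
open import Data.List.Relation.Unary.Unique.Propositional using (Unique)
import Data.List.Relation.Unary.Unique.Propositional.Properties as Unique
open import Data.Nat.Base as ℕ using (ℕ; zero; suc; _∸_; _≤_; _<_; _<ᵇ_; z≤n; s≤s)
import Data.Nat.Induction as ℕ
import Data.Nat.Properties as ℕ
open import Data.Product.Base using (_×_; _,_)
open import Data.Rational.Base using (ℚ; 0ℚ; 1ℚ; ≢-nonZero; 1/_)
import Data.Rational.Base as ℚ
import Data.Rational.Properties as ℚ
open import Function.Base using (_∘_; _$_)
open import Function.Bundles using (_⇔_; mk⇔)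
open import Level using (Level; _⊔_; 0ℓ)
open import Relation.Binary.PropositionalEquality as ≡ using (_≡_; _≢_)
open import Relation.Nullary.Decidable using (¬?; decidable-stable)
open import Relation.Nullary.Decidable.Core using (Dec)
open import Relation.Nullary.Negation using (¬_; contradiction)
import Relation.Binary.Reasoning.Setoid as SetoidReasoning

private variable
  ℓ₁ ℓ₂ : Level

-- Permutations are in one-line notation: lists of the letters 1,…,n.

insertions : ℕ → List ℕ → List (List ℕ)
insertions x []       = (x ∷ []) ∷ []
insertions x (y ∷ ys) = (x ∷ y ∷ ys) ∷ map (y ∷_) (insertions x ys)

-- An enumeration of the permutations of {1,…,n}: see ∈𝔖⇔↭ and 𝔖-unique.
𝔖 : ℕ → List (List ℕ)
𝔖 zero    = [] ∷ []
𝔖 (suc n) = concatMap (insertions (suc n)) (𝔖 n)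

des : List ℕ → ℕ
des (x ∷ y ∷ π) = (if y <ᵇ x then 1 else 0) ℕ.+ des (y ∷ π)
des _           = 0

interiorPeaks : List ℕ → ℕ
interiorPeaks (x ∷ y ∷ z ∷ π) =
  (if x <ᵇ y then (if z <ᵇ y then 1 else 0) else 0) ℕ.+ interiorPeaks (y ∷ z ∷ π)
interiorPeaks _               = 0

-- The first summand accounts for a left peak in position 1.
lpk : List ℕ → ℕ
lpk π@(x ∷ y ∷ _) = (if y <ᵇ x then 1 else 0) ℕ.+ interiorPeaks π
lpk _             = 0

insertions-↭ : ∀ x ys {π} → π ∈ insertions x ys → π ↭ x ∷ ys
insertions-↭ x []       (here ≡.refl) = ↭-refl
insertions-↭ x (y ∷ ys) (here ≡.refl) = ↭-refl
insertions-↭ x (y ∷ ys) (there π∈) with ∈-map⁻ (y ∷_) π∈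
... | σ , σ∈ , ≡.refl = ↭-trans (prep y (insertions-↭ x ys σ∈)) (swap y x ↭-refl)

∈-insertions : ∀ x ps qs → ps ++ x ∷ qs ∈ insertions x (ps ++ qs)
∈-insertions x []       []       = here ≡.refl
∈-insertions x []       (_ ∷ _)  = here ≡.refl
∈-insertions x (p ∷ ps) qs       = there (∈-map⁺ (p ∷_) (∈-insertions x ps qs))

∈𝔖⇒↭ : ∀ n {π} → π ∈ 𝔖 n → π ↭ applyDownFrom suc n
∈𝔖⇒↭ zero    (here ≡.refl) = ↭-refl
∈𝔖⇒↭ (suc n) π∈ with find (∈-concatMap⁻ (insertions (suc n)) {xs = 𝔖 n} π∈)
... | σ , σ∈ , π∈σ = ↭-trans (insertions-↭ (suc n) σ π∈σ) (prep (suc n) (∈𝔖⇒↭ n σ∈))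

↭⇒∈𝔖 : ∀ n {π} → π ↭ applyDownFrom suc n → π ∈ 𝔖 n
↭⇒∈𝔖 zero    π↭ with ↭-empty-inv π↭
... | ≡.refl = here ≡.refl
↭⇒∈𝔖 (suc n) π↭ with ∈-∃++ (∈-resp-↭ (↭-sym π↭) (here ≡.refl))
... | ps , qs , ≡.refl =
  ∈-concatMap⁺ (insertions (suc n))
    (Any.map (λ { ≡.refl → ∈-insertions (suc n) ps qs })
             (↭⇒∈𝔖 n (drop-mid ps [] π↭)))

∈𝔖⇔↭ : ∀ n {π} → (π ∈ 𝔖 n) ⇔ (π ↭ applyDownFrom suc n)
∈𝔖⇔↭ n = mk⇔ (∈𝔖⇒↭ n) (↭⇒∈𝔖 n)

private
  ≢? : ∀ x y → Dec (y ≢ x)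
  ≢? x y = ¬? (y ℕ.≟ x)

  remove : ℕ → List ℕ → List ℕ
  remove x = filter (≢? x)

  remove-insertions : ∀ x ys {π} → x ∉ ys → π ∈ insertions x ys → remove x π ≡ ys
  remove-insertions x ys {π} x∉ π∈ = go ys x∉ π∈
    where
    keep : ∀ ys → x ∉ ys → remove x ys ≡ ys
    keep ys x∉ = filter-all (≢? x) (All.map (λ x≢y y≡x → x≢y (≡.sym y≡x)) (All.¬Any⇒All¬ ys x∉))
    go : ∀ ys {π} → x ∉ ys → π ∈ insertions x ys → remove x π ≡ ys
    go []       x∉ (here ≡.refl) = filter-reject (≢? x) {xs = []} (λ x≢x → x≢x ≡.refl)
    go (y ∷ ys) x∉ (here ≡.refl) =
      ≡.trans (filter-reject (≢? x) {xs = y ∷ ys} (λ x≢x → x≢x ≡.refl)) (keep (y ∷ ys) x∉)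
    go (y ∷ ys) x∉ (there π∈) with ∈-map⁻ (y ∷_) π∈
    ... | σ , σ∈ , ≡.refl =
      ≡.trans (filter-accept (≢? x) {xs = σ} (λ y≡x → x∉ (here (≡.sym y≡x))))
              (≡.cong (y ∷_) (go ys (x∉ ∘ there) σ∈))

  insertions-unique : ∀ x ys → x ∉ ys → Unique (insertions x ys)
  insertions-unique x []       x∉ = [] ∷ []
  insertions-unique x (y ∷ ys) x∉ =
    All.map⁺ (All.tabulate (λ _ e → x∉ (here (∷-injectiveˡ e))))
    ∷ Unique.map⁺ ∷-injectiveʳ (insertions-unique x ys (x∉ ∘ there))

  fresh : ∀ n {π} → π ∈ 𝔖 n → suc n ∉ π
  fresh n π∈ 1+n∈π = bounded n (∈-resp-↭ (∈𝔖⇒↭ n π∈) 1+n∈π) ℕ.≤-refl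
    where
    bounded : ∀ m {k} → k ∈ applyDownFrom suc m → ¬ (m < k)
    bounded (suc m) (here ≡.refl) = ℕ.<-irrefl ≡.refl
    bounded (suc m) (there k∈)    = bounded m k∈ ∘ ℕ.<-trans (ℕ.n<1+n m)

𝔖-unique : ∀ n → Unique (𝔖 n)
𝔖-unique zero    = [] ∷ []
𝔖-unique (suc n) = Unique.concat⁺
  (All.map⁺ (All.tabulate (λ {σ} σ∈ → insertions-unique (suc n) σ (fresh n σ∈))))
  (AllPairs.map⁺ (pairs (𝔖 n) (fresh n) (𝔖-unique n)))
  where
  pairs : ∀ ss → (∀ {σ} → σ ∈ ss → suc n ∉ σ) → Unique ss →
          AllPairs (λ σ τ → Disjoint (insertions (suc n) σ) (insertions (suc n) τ)) ss
  pairs []       f []       = []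
  pairs (σ ∷ ss) f (d ∷ u) =
    All.tabulate (λ {τ} τ∈ (a , b) → All.lookup d τ∈
      (≡.trans (≡.sym (remove-insertions _ σ (f (here ≡.refl)) a))
               (remove-insertions _ τ (f (there τ∈)) b)))
    ∷ pairs ss (f ∘ there) u

-- Stability holds automatically for a classical or decidable equality; it
-- is what makes power series over a domain a domain constructively.
record IsIntegralDomain (R : CommutativeRing ℓ₁ ℓ₂) : Set (ℓ₁ ⊔ ℓ₂) where
  open CommutativeRing R
  field
    1≉0            : 1# ≉ 0#
    ≈-stable       : ∀ {x y} → ¬ (x ≉ y) → x ≈ y
    noZeroDivisors : ∀ {x y} → x ≉ 0# → x * y ≈ 0# → y ≈ 0#

  *-nonzero : ∀ {x y} → x ≉ 0# → y ≉ 0# → x * y ≉ 0#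
  *-nonzero x≉0 y≉0 xy≈0 = y≉0 (noZeroDivisors x≉0 xy≈0)

  *-cancelˡ-nonzero : ∀ {x y z} → x ≉ 0# → x * y ≈ x * z → y ≈ z
  *-cancelˡ-nonzero {x} {y} {z} x≉0 xy≈xz =
    x∙y⁻¹≈ε⇒x≈y y z $ noZeroDivisors x≉0 $ begin
      x * (y + - z)      ≈⟨ distribˡ x y (- z) ⟩
      x * y + x * - z    ≈⟨ +-cong xy≈xz (sym (-‿distribʳ-* x z)) ⟩
      x * z + - (x * z)  ≈⟨ -‿inverseʳ (x * z) ⟩
      0#                 ∎
    where
    open RingProperties ring using (x∙y⁻¹≈ε⇒x≈y; -‿distribʳ-*)
    open SetoidReasoning setoid

ℚ-isIntegralDomain : IsIntegralDomain ℚ.+-*-commutativeRing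
ℚ-isIntegralDomain = record
  { 1≉0            = λ ()
  ; ≈-stable       = λ {x} {y} → decidable-stable (x ℚ.≟ y)
  ; noZeroDivisors = λ {x} {y} x≢0 xy≡0 →
      let instance _ = ≢-nonZero x≢0 in begin
        y                  ≡⟨ ℚ.*-identityˡ y ⟨
        1ℚ ℚ.* y           ≡⟨ ≡.cong (ℚ._* y) (ℚ.*-inverseˡ x) ⟨
        1/ x ℚ.* x ℚ.* y   ≡⟨ ℚ.*-assoc (1/ x) x y ⟩
        1/ x ℚ.* (x ℚ.* y) ≡⟨ ≡.cong (1/ x ℚ.*_) xy≡0 ⟩
        1/ x ℚ.* 0ℚ        ≡⟨ ℚ.*-zeroʳ (1/ x) ⟩
        0ℚ                 ∎
  }
  where open ≡.≡-Reasoning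

module PowerSeries (R : CommutativeRing ℓ₁ ℓ₂) where
  private
    module R = CommutativeRing R
    open R using (0#; 1#)
    open Sum R.semiring
    open SetoidReasoning R.setoid

  Series : Set ℓ₁
  Series = ℕ → R.Carrier

  infix 4 _≈_
  record _≈_ (f g : Series) : Set ℓ₂ where
    constructor pointwise
    field at : ∀ n → f n R.≈ g n
  open _≈_ public

  infixl 6 _+_
  infixl 7 _*_

  _+_ : Series → Series → Series
  (f + g) n = f n R.+ g n

  -_ : Series → Series
  (- f) n = R.- f n

  _*_ : Series → Series → Series
  (f * g) n = ∑[ i ≤ n ] (f (toℕ i) R.* g (n ∸ toℕ i))

  const : R.Carrier → Series
  const a zero    = a
  const a (suc _) = 0#

  X : Series
  X 1 = 1#
  X _ = 0#

  0ₛ 1ₛ : Series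
  0ₛ _ = 0#
  1ₛ   = const 1#

  private
    tail : Series → Series
    tail f n = f (suc n)

    *-cong : ∀ {f f′ g g′} → f ≈ f′ → g ≈ g′ → f * g ≈ f′ * g′
    *-cong p q .at n = sum-cong-≋ {suc n} (λ i → R.*-cong (p .at (toℕ i)) (q .at (n ∸ toℕ i)))

    *-sucʳ : ∀ f g n → (f * g) (suc n) R.≈ (f * tail g) n R.+ f (suc n) R.* g 0
    *-sucʳ f g zero = R.trans (R.+-congˡ (R.+-identityʳ _)) (R.+-congʳ (R.sym (R.+-identityʳ _)))
    *-sucʳ f g (suc n) = R.trans (R.+-congˡ (*-sucʳ (tail f) g n)) (R.sym (R.+-assoc _ _ _))

    *-comm : ∀ f g n → (f * g) n R.≈ (g * f) n
    *-comm f g zero    = R.+-congʳ (R.*-comm _ _)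
    *-comm f g (suc n) = begin
      f 0 R.* g (suc n) R.+ (tail f * g) n  ≈⟨ R.+-cong (R.*-comm _ _) (*-comm (tail f) g n) ⟩
      g (suc n) R.* f 0 R.+ (g * tail f) n  ≈⟨ R.+-comm _ _ ⟩
      (g * tail f) n R.+ g (suc n) R.* f 0  ≈⟨ *-sucʳ g f n ⟨
      (g * f) (suc n)                       ∎

    *-distribʳ : ∀ h f g n → ((f + g) * h) n R.≈ (f * h) n R.+ (g * h) n
    *-distribʳ h f g n = begin
      ((f + g) * h) n
        ≈⟨ sum-cong-≋ {suc n} (λ i → R.distribʳ (h (n ∸ toℕ i)) (f (toℕ i)) (g (toℕ i))) ⟩
      ∑[ i ≤ n ] (f (toℕ i) R.* h (n ∸ toℕ i) R.+ g (toℕ i) R.* h (n ∸ toℕ i))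
        ≈⟨ ∑-distrib-+ {suc n} (λ i → f (toℕ i) R.* h (n ∸ toℕ i)) (λ i → g (toℕ i) R.* h (n ∸ toℕ i)) ⟩
      (f * h) n R.+ (g * h) n ∎

    *-scale : ∀ a f g n → ((λ m → a R.* f m) * g) n R.≈ a R.* (f * g) n
    *-scale a f g n = begin
      ∑[ i ≤ n ] (a R.* f (toℕ i) R.* g (n ∸ toℕ i))
        ≈⟨ sum-cong-≋ {suc n} (λ i → R.*-assoc a (f (toℕ i)) (g (n ∸ toℕ i))) ⟩
      ∑[ i ≤ n ] (a R.* (f (toℕ i) R.* g (n ∸ toℕ i)))
        ≈⟨ *-distribˡ-sum {suc n} a (λ i → f (toℕ i) R.* g (n ∸ toℕ i)) ⟨
      a R.* (f * g) n ∎

    *-assoc : ∀ f g h n → ((f * g) * h) n R.≈ (f * (g * h)) n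
    *-assoc f g h zero = R.+-congʳ (begin
      (f 0 R.* g 0 R.+ 0#) R.* h 0    ≈⟨ R.*-congʳ (R.+-identityʳ _) ⟩
      f 0 R.* g 0 R.* h 0             ≈⟨ R.*-assoc _ _ _ ⟩
      f 0 R.* (g 0 R.* h 0)           ≈⟨ R.*-congˡ (R.+-identityʳ _) ⟨
      f 0 R.* (g 0 R.* h 0 R.+ 0#)    ∎)
    *-assoc f g h (suc n) = begin
      (f 0 R.* g 0 R.+ 0#) R.* h (suc n) R.+ (((λ m → f 0 R.* g (suc m)) + (tail f * g)) * h) n
        ≈⟨ R.+-cong (R.trans (R.*-congʳ (R.+-identityʳ _)) (R.*-assoc _ _ _))
                    (*-distribʳ h (λ m → f 0 R.* g (suc m)) (tail f * g) n) ⟩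
      f 0 R.* (g 0 R.* h (suc n)) R.+ (((λ m → f 0 R.* g (suc m)) * h) n R.+ ((tail f * g) * h) n)
        ≈⟨ R.+-congˡ (R.+-cong (*-scale (f 0) (tail g) h n) (*-assoc (tail f) g h n)) ⟩
      f 0 R.* (g 0 R.* h (suc n)) R.+ (f 0 R.* (tail g * h) n R.+ (tail f * (g * h)) n)
        ≈⟨ R.+-assoc _ _ _ ⟨
      f 0 R.* (g 0 R.* h (suc n)) R.+ f 0 R.* (tail g * h) n R.+ (tail f * (g * h)) n
        ≈⟨ R.+-congʳ (R.distribˡ _ _ _) ⟨
      f 0 R.* (g * h) (suc n) R.+ (tail f * (g * h)) n ∎

    vanishingˡ : ∀ f g n → (∀ m → f m R.≈ 0#) → (f * g) n R.≈ 0#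
    vanishingˡ f g zero    f≈0 =
      R.trans (R.+-identityʳ _) (R.trans (R.*-congʳ (f≈0 0)) (R.zeroˡ _))
    vanishingˡ f g (suc n) f≈0 =
      R.trans (R.+-cong (R.trans (R.*-congʳ (f≈0 0)) (R.zeroˡ _))
                        (vanishingˡ (tail f) g n (f≈0 ∘ suc)))
              (R.+-identityˡ 0#)

    vanishingʳ : ∀ f g n → (∀ m → m ≤ n → g m R.≈ 0#) → (f * g) n R.≈ 0#
    vanishingʳ f g zero    g≈0 =
      R.trans (R.+-identityʳ _) (R.trans (R.*-congˡ (g≈0 0 z≤n)) (R.zeroʳ _))
    vanishingʳ f g (suc n) g≈0 =
      R.trans (R.+-cong (R.trans (R.*-congˡ (g≈0 (suc n) ℕ.≤-refl)) (R.zeroʳ _))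
                        (vanishingʳ (tail f) g n (λ m m≤n → g≈0 m (ℕ.m≤n⇒m≤1+n m≤n))))
              (R.+-identityˡ 0#)

    *-identityˡ : ∀ f n → (1ₛ * f) n R.≈ f n
    *-identityˡ f zero    = R.trans (R.+-identityʳ _) (R.*-identityˡ _)
    *-identityˡ f (suc n) =
      R.trans (R.+-cong (R.*-identityˡ _) (vanishingˡ (tail 1ₛ) f n (λ _ → R.refl)))
              (R.+-identityʳ _)

  *-finiteSupport : ∀ f g a b → (∀ {n} → a ≤ n → f n R.≈ 0#) → (∀ {n} → b ≤ n → g n R.≈ 0#) →
                    ∀ {n} → a ℕ.+ b ≤ n → (f * g) n R.≈ 0#
  *-finiteSupport f g zero    b f≈0 g≈0 {n} _ = vanishingˡ f g n (λ m → f≈0 z≤n)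
  *-finiteSupport f g (suc a) b f≈0 g≈0 {suc n} (s≤s a+b≤n) =
    R.trans (R.+-cong (R.trans (R.*-congˡ (g≈0 (ℕ.m≤n⇒m≤1+n (ℕ.≤-trans (ℕ.m≤n+m b a) a+b≤n)))) (R.zeroʳ _))
                      (*-finiteSupport (tail f) g a b (f≈0 ∘ s≤s) g≈0 a+b≤n))
            (R.+-identityˡ 0#)

  commutativeRing : CommutativeRing ℓ₁ ℓ₂
  commutativeRing = record
    { Carrier = Series ; _≈_ = _≈_ ; _+_ = _+_ ; _*_ = _*_ ; -_ = -_ ; 0# = 0ₛ ; 1# = 1ₛ
    ; isCommutativeRing = record
      { isRing = record
        { +-isAbelianGroup = record
          { isGroup = record
            { isMonoid = record
              { isSemigroup = record
                { isMagma = record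
                  { isEquivalence = record
                    { refl  = pointwise λ _ → R.refl
                    ; sym   = λ p → pointwise λ n → R.sym (p .at n)
                    ; trans = λ p q → pointwise λ n → R.trans (p .at n) (q .at n)
                    }
                  ; ∙-cong = λ p q → pointwise λ n → R.+-cong (p .at n) (q .at n)
                  }
                ; assoc = λ f g h → pointwise λ n → R.+-assoc (f n) (g n) (h n)
                }
              ; identity = (λ f → pointwise λ n → R.+-identityˡ (f n))
                         , (λ f → pointwise λ n → R.+-identityʳ (f n))
              }
            ; inverse = (λ f → pointwise λ n → R.-‿inverseˡ (f n))
                      , (λ f → pointwise λ n → R.-‿inverseʳ (f n))
            ; ⁻¹-cong = λ p → pointwise λ n → R.-‿cong (p .at n)
            }
          ; comm = λ f g → pointwise λ n → R.+-comm (f n) (g n)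
          }
        ; *-cong     = *-cong
        ; *-assoc    = λ f g h → pointwise (*-assoc f g h)
        ; *-identity = (λ f → pointwise (*-identityˡ f))
                     , (λ f → pointwise λ n → R.trans (*-comm f 1ₛ n) (*-identityˡ f n))
        ; distrib    = (λ h f g → pointwise λ n → begin
                           (h * (f + g)) n          ≈⟨ *-comm h (f + g) n ⟩
                           ((f + g) * h) n          ≈⟨ *-distribʳ h f g n ⟩
                           (f * h) n R.+ (g * h) n  ≈⟨ R.+-cong (*-comm f h n) (*-comm g h n) ⟩
                           (h * f) n R.+ (h * g) n  ∎)
                     , (λ h f g → pointwise (*-distribʳ h f g))
        }
      ; *-comm = λ f g → pointwise (*-comm f g)
      }
    }

  module _ (dom : IsIntegralDomain R) where
    private
      open IsIntegralDomain dom

      *-lowest : ∀ f g i m → (∀ {a} → a < i → f a R.≈ 0#) → (∀ {b} → b < m → g b R.≈ 0#) →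
                 (f * g) (i ℕ.+ m) R.≈ f i R.* g m
      *-lowest f g zero zero       f≈0 g≈0 = R.+-identityʳ _
      *-lowest f g zero (suc m)    f≈0 g≈0 =
        R.trans (R.+-congˡ (vanishingʳ (tail f) g m (λ b b≤m → g≈0 (s≤s b≤m)))) (R.+-identityʳ _)
      *-lowest f g (suc i) m f≈0 g≈0 =
        R.trans (R.+-cong (R.trans (R.*-congʳ (f≈0 (s≤s z≤n))) (R.zeroˡ _))
                          (*-lowest (tail f) g i m (f≈0 ∘ s≤s) g≈0))
                (R.+-identityˡ _)

      series-noZeroDivisors : ∀ {f g} → ¬ (f ≈ 0ₛ) → f * g ≈ 0ₛ → g ≈ 0ₛ
      series-noZeroDivisors {f} {g} f≉0 fg≈0 = pointwise (ℕ.<-rec (λ m → g m R.≈ 0#) step)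
        where
        step : ∀ m → (∀ {b} → b < m → g b R.≈ 0#) → g m R.≈ 0#
        step m g≈0 = ≈-stable λ gm≉0 → f≉0 (pointwise (ℕ.<-rec (λ i → f i R.≈ 0#) λ i f≈0 →
          noZeroDivisors gm≉0 (begin
            g m R.* f i        ≈⟨ R.*-comm (g m) (f i) ⟩
            f i R.* g m        ≈⟨ *-lowest f g i m f≈0 g≈0 ⟨
            (f * g) (i ℕ.+ m)  ≈⟨ fg≈0 .at (i ℕ.+ m) ⟩
            0#                 ∎)))

    isIntegralDomain : IsIntegralDomain commutativeRing
    isIntegralDomain = record
      { 1≉0            = λ p → 1≉0 (p .at 0)
      ; ≈-stable       = λ ¬¬p → pointwise λ n → ≈-stable λ ¬q → ¬¬p λ p → ¬q (p .at n)
      ; noZeroDivisors = series-noZeroDivisors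
      }

-- A polynomial is a power series with an explicit bound beyond which all
-- coefficients vanish; the bound plays no role in equality.
module Polynomial (R : CommutativeRing ℓ₁ ℓ₂) where
  private
    module R = CommutativeRing R
    module S = PowerSeries R
    module SR = CommutativeRing S.commutativeRing

  record Poly : Set (ℓ₁ ⊔ ℓ₂) where
    no-eta-equality
    field
      coeff  : S.Series
      bound  : ℕ
      vanish : ∀ {n} → bound ≤ n → coeff n R.≈ R.0#
  open Poly public

  infix 4 _≈_
  record _≈_ (p q : Poly) : Set ℓ₂ where
    constructor coeffwise
    field coeff-≈ : coeff p S.≈ coeff q
  open _≈_ public

  infixl 6 _+_
  infixl 7 _*_

  _+_ : Poly → Poly → Poly
  (p + q) .coeff    = coeff p S.+ coeff q
  (p + q) .bound    = bound p ℕ.⊔ bound q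
  (p + q) .vanish h = R.trans
    (R.+-cong (vanish p (ℕ.m⊔n≤o⇒m≤o (bound p) (bound q) h))
              (vanish q (ℕ.m⊔n≤o⇒n≤o (bound p) (bound q) h)))
    (R.+-identityˡ R.0#)

  -_ : Poly → Poly
  (- p) .coeff    = S.- coeff p
  (- p) .bound    = bound p
  (- p) .vanish h = R.trans (R.-‿cong (vanish p h)) -0#≈0#
    where open RingProperties R.ring using (-0#≈0#)

  _*_ : Poly → Poly → Poly
  (p * q) .coeff  = coeff p S.* coeff q
  (p * q) .bound  = bound p ℕ.+ bound q
  (p * q) .vanish = S.*-finiteSupport (coeff p) (coeff q) (bound p) (bound q) (vanish p) (vanish q)

  const : R.Carrier → Poly
  const a .coeff          = S.const a
  const a .bound          = 1
  const a .vanish (s≤s _) = R.refl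

  X : Poly
  X .coeff                = S.X
  X .bound                = 2
  X .vanish (s≤s (s≤s _)) = R.refl

  0ₚ 1ₚ : Poly
  0ₚ .coeff    = S.0ₛ
  0ₚ .bound    = 0
  0ₚ .vanish _ = R.refl
  1ₚ           = const R.1#

  rawRing : RawRing (ℓ₁ ⊔ ℓ₂) ℓ₂
  rawRing = record { Carrier = Poly ; _≈_ = _≈_ ; _+_ = _+_ ; _*_ = _*_ ; -_ = -_ ; 0# = 0ₚ ; 1# = 1ₚ }

  coeff-isRingMonomorphism : IsRingMonomorphism rawRing SR.rawRing coeff
  coeff-isRingMonomorphism = record
    { isRingHomomorphism = record
      { isSemiringHomomorphism = record
        { isNearSemiringHomomorphism = record
          { +-isMonoidHomomorphism = record
            { isMagmaHomomorphism = record
              { isRelHomomorphism = record { cong = coeff-≈ }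
              ; homo = λ _ _ → SR.refl
              }
            ; ε-homo = SR.refl
            }
          ; *-homo = λ _ _ → SR.refl
          }
        ; 1#-homo = SR.refl
        }
      ; -‿homo = λ _ → SR.refl
      }
    ; injective = coeffwise
    }

  commutativeRing : CommutativeRing (ℓ₁ ⊔ ℓ₂) ℓ₂
  commutativeRing = record
    { RawRing rawRing
    ; isCommutativeRing =
        RingMonomorphism.isCommutativeRing coeff-isRingMonomorphism SR.isCommutativeRing
    }

  isIntegralDomain : IsIntegralDomain R → IsIntegralDomain commutativeRing
  isIntegralDomain dom = record
    { 1≉0            = λ p → D.1≉0 (coeff-≈ p)
    ; ≈-stable       = λ ¬¬p → coeffwise (D.≈-stable λ ¬q → ¬¬p λ p → ¬q (coeff-≈ p))
    ; noZeroDivisors = λ p≉0 pq≈0 → coeffwise (D.noZeroDivisors (p≉0 ∘ coeffwise) (coeff-≈ pq≈0))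
    }
    where module D = IsIntegralDomain (S.isIntegralDomain dom)

module Fractions (R : CommutativeRing ℓ₁ ℓ₂) (dom : IsIntegralDomain R) where
  private
    module R = CommutativeRing R
    open IsIntegralDomain dom
    open Solver R.commutativeSemiring using (solve; _:=_; _:+_; _:*_)
    open SetoidReasoning R.setoid

  infix 8 _/_⟨_⟩
  record Fraction : Set (ℓ₁ ⊔ ℓ₂) where
    no-eta-equality
    constructor _/_⟨_⟩
    field
      num   : R.Carrier
      den   : R.Carrier
      den≉0 : den R.≉ R.0#
  open Fraction public

  infix 4 _≈_
  record _≈_ (p q : Fraction) : Set ℓ₂ where
    constructor crossEqual
    field cross : num p R.* den q R.≈ num q R.* den p
  open _≈_ public

  infixl 6 _+_
  infixl 7 _*_

  _+_ _*_ : Fraction → Fraction → Fraction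
  (p + q) .num   = num p R.* den q R.+ num q R.* den p
  (p + q) .den   = den p R.* den q
  (p + q) .den≉0 = *-nonzero (den≉0 p) (den≉0 q)

  (p * q) .num   = num p R.* num q
  (p * q) .den   = den p R.* den q
  (p * q) .den≉0 = *-nonzero (den≉0 p) (den≉0 q)

  -_ : Fraction → Fraction
  (- p) .num   = R.- num p
  (- p) .den   = den p
  (- p) .den≉0 = den≉0 p

  ι : R.Carrier → Fraction
  ι a = a / R.1# ⟨ 1≉0 ⟩

  private
    ≈-trans : ∀ {p q r} → p ≈ q → q ≈ r → p ≈ r
    ≈-trans {p} {q} {r} (crossEqual ad≈cb) (crossEqual cf≈ed) =
      crossEqual $ *-cancelˡ-nonzero (den≉0 q) $ begin
        d R.* (a R.* f)  ≈⟨ solve 3 (λ a d f → (d :* (a :* f)) := ((a :* d) :* f)) R.refl a d f ⟩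
        (a R.* d) R.* f  ≈⟨ R.*-congʳ ad≈cb ⟩
        (c R.* b) R.* f  ≈⟨ solve 3 (λ c b f → ((c :* b) :* f) := ((c :* f) :* b)) R.refl c b f ⟩
        (c R.* f) R.* b  ≈⟨ R.*-congʳ cf≈ed ⟩
        (e R.* d) R.* b  ≈⟨ solve 3 (λ e d b → ((e :* d) :* b) := (d :* (e :* b))) R.refl e d b ⟩
        d R.* (e R.* b)  ∎
      where
      a = num p ; b = den p
      c = num q ; d = den q
      e = num r ; f = den r

    +-cong : ∀ {p p′ q q′} → p ≈ p′ → q ≈ q′ → p + q ≈ p′ + q′
    +-cong {p} {p′} {q} {q′} (crossEqual e₁) (crossEqual e₂) =
      crossEqual $ begin
        (a R.* d R.+ c R.* b) R.* (b′ R.* d′)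
          ≈⟨ solve 6 (λ a b c d b′ d′ → ((a :* d :+ c :* b) :* (b′ :* d′)) :=
                       ((a :* b′) :* (d :* d′) :+ (c :* d′) :* (b :* b′))) R.refl a b c d b′ d′ ⟩
        (a R.* b′) R.* (d R.* d′) R.+ (c R.* d′) R.* (b R.* b′)
          ≈⟨ R.+-cong (R.*-congʳ e₁) (R.*-congʳ e₂) ⟩
        (a′ R.* b) R.* (d R.* d′) R.+ (c′ R.* d) R.* (b R.* b′)
          ≈⟨ solve 6 (λ a′ b c′ d b′ d′ → ((a′ :* b) :* (d :* d′) :+ (c′ :* d) :* (b :* b′)) :=
                       ((a′ :* d′ :+ c′ :* b′) :* (b :* d))) R.refl a′ b c′ d b′ d′ ⟩
        (a′ R.* d′ R.+ c′ R.* b′) R.* (b R.* d) ∎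
      where
      a = num p ; b = den p
      a′ = num p′ ; b′ = den p′
      c = num q ; d = den q
      c′ = num q′ ; d′ = den q′

    *-cong : ∀ {p p′ q q′} → p ≈ p′ → q ≈ q′ → p * q ≈ p′ * q′
    *-cong {p} {p′} {q} {q′} (crossEqual e₁) (crossEqual e₂) =
      crossEqual $ begin
        (a R.* c) R.* (b′ R.* d′)
          ≈⟨ solve 4 (λ a c b′ d′ → ((a :* c) :* (b′ :* d′)) := ((a :* b′) :* (c :* d′))) R.refl a c b′ d′ ⟩
        (a R.* b′) R.* (c R.* d′)
          ≈⟨ R.*-cong e₁ e₂ ⟩
        (a′ R.* b) R.* (c′ R.* d)
          ≈⟨ solve 4 (λ a′ b c′ d → ((a′ :* b) :* (c′ :* d)) := ((a′ :* c′) :* (b :* d))) R.refl a′ b c′ d ⟩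
        (a′ R.* c′) R.* (b R.* d) ∎
      where
      a = num p ; b = den p
      a′ = num p′ ; b′ = den p′
      c = num q ; d = den q
      c′ = num q′ ; d′ = den q′

    -‿cong : ∀ {p q} → p ≈ q → - p ≈ - q
    -‿cong {p} {q} (crossEqual e₁) = crossEqual $ begin
      (R.- a) R.* d  ≈⟨ -‿distribˡ-* a d ⟨
      R.- (a R.* d)  ≈⟨ R.-‿cong e₁ ⟩
      R.- (c R.* b)  ≈⟨ -‿distribˡ-* c b ⟩
      (R.- c) R.* b  ∎
      where
      open RingProperties R.ring using (-‿distribˡ-*)
      a = num p ; b = den p
      c = num q ; d = den q

    +-comm : ∀ p q → p + q ≈ q + p
    +-comm p q = crossEqual $ R.*-cong (R.+-comm _ _) (R.*-comm (den q) (den p))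

    +-assoc : ∀ p q r → (p + q) + r ≈ p + (q + r)
    +-assoc p q r = crossEqual $
      solve 6 (λ a b c d e f →
        (((a :* d :+ c :* b) :* f :+ e :* (b :* d)) :* (b :* (d :* f))) :=
        ((a :* (d :* f) :+ (c :* f :+ e :* d) :* b) :* ((b :* d) :* f))) R.refl a b c d e f
      where
      a = num p ; b = den p
      c = num q ; d = den q
      e = num r ; f = den r

    +-identityˡ : ∀ p → ι R.0# + p ≈ p
    +-identityˡ p = crossEqual $ begin
      (R.0# R.* b R.+ a R.* R.1#) R.* b  ≈⟨ R.*-congʳ (R.+-cong (R.zeroˡ b) (R.*-identityʳ a)) ⟩
      (R.0# R.+ a) R.* b                 ≈⟨ R.*-cong (R.+-identityˡ a) (R.sym (R.*-identityˡ b)) ⟩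
      a R.* (R.1# R.* b)                 ∎
      where
      a = num p ; b = den p

    -‿inverseˡ : ∀ p → - p + p ≈ ι R.0#
    -‿inverseˡ p = crossEqual $ begin
      ((R.- a) R.* b R.+ a R.* b) R.* R.1#  ≈⟨ R.*-identityʳ _ ⟩
      (R.- a) R.* b R.+ a R.* b             ≈⟨ R.distribʳ b (R.- a) a ⟨
      (R.- a R.+ a) R.* b                   ≈⟨ R.*-congʳ (R.-‿inverseˡ a) ⟩
      R.0# R.* b                            ≈⟨ R.zeroˡ b ⟩
      R.0#                                  ≈⟨ R.zeroˡ (b R.* b) ⟨
      R.0# R.* (b R.* b)                    ∎
      where
      a = num p ; b = den p

    *-comm : ∀ p q → p * q ≈ q * p
    *-comm p q = crossEqual $ R.*-cong (R.*-comm a c) (R.*-comm d b)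
      where
      a = num p ; b = den p
      c = num q ; d = den q

    *-assoc : ∀ p q r → (p * q) * r ≈ p * (q * r)
    *-assoc p q r = crossEqual $
      R.*-cong (R.*-assoc a c e) (R.sym (R.*-assoc b d f))
      where
      a = num p ; b = den p
      c = num q ; d = den q
      e = num r ; f = den r

    *-identityˡ : ∀ p → ι R.1# * p ≈ p
    *-identityˡ p = crossEqual $
      R.*-cong (R.*-identityˡ a) (R.sym (R.*-identityˡ b))
      where
      a = num p ; b = den p

    distribʳ : ∀ r p q → (p + q) * r ≈ p * r + q * r
    distribʳ r p q = crossEqual $
      solve 6 (λ a b c d e f →
        (((a :* d :+ c :* b) :* e) :* ((b :* f) :* (d :* f))) :=
        (((a :* e) :* (d :* f) :+ (c :* e) :* (b :* f)) :* ((b :* d) :* f))) R.refl a b c d e f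
      where
      e = num r ; f = den r
      a = num p ; b = den p
      c = num q ; d = den q

  commutativeRing : CommutativeRing (ℓ₁ ⊔ ℓ₂) ℓ₂
  commutativeRing = record
    { Carrier = Fraction ; _≈_ = _≈_ ; _+_ = _+_ ; _*_ = _*_ ; -_ = -_ ; 0# = ι R.0# ; 1# = ι R.1#
    ; isCommutativeRing = record
      { isRing = record
        { +-isAbelianGroup = record
          { isGroup = record
            { isMonoid = record
              { isSemigroup = record
                { isMagma = record
                  { isEquivalence = record
                    { refl  = crossEqual R.refl
                    ; sym   = λ p → crossEqual (R.sym (cross p))
                    ; trans = ≈-trans
                    }
                  ; ∙-cong = +-cong
                  }
                ; assoc = +-assoc
                }
              ; identity = +-identityˡ , λ p → ≈-trans (+-comm p _) (+-identityˡ p)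
              }
            ; inverse = -‿inverseˡ , λ p → ≈-trans (+-comm p _) (-‿inverseˡ p)
            ; ⁻¹-cong = -‿cong
            }
          ; comm = +-comm
          }
        ; *-cong     = *-cong
        ; *-assoc    = *-assoc
        ; *-identity = *-identityˡ , λ p → ≈-trans (*-comm p _) (*-identityˡ p)
        ; distrib    = (λ r p q → ≈-trans (*-comm r _) (≈-trans (distribʳ r p q)
                                    (+-cong (*-comm p r) (*-comm q r))))
                     , distribʳ
        }
      ; *-comm = *-comm
      }
    }

-- Aₙ and Pₙ have natural number coefficients, so they can be evaluated in
-- any commutative ring; at the indeterminates of a ring of polynomials,
-- rational functions or series they are the polynomials themselves.
module Eulerian (R : CommutativeRing ℓ₁ ℓ₂) where
  open CommutativeRing R public hiding (zero)
  open Exp commutativeSemiring public using (_^_)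
  open Sum semiring public using (sum⁺-syntax)

  infixr 8 _·_
  _·_ : ℕ → Carrier → Carrier
  _·_ = Mult._×_ semiring

  ∑𝔖 : ℕ → (List ℕ → Carrier) → Carrier
  ∑𝔖 n f = foldr _+_ 0# (map f (𝔖 n))

  A : ℕ → Carrier → Carrier
  A zero      t = 1#
  A n@(suc _) t = ∑𝔖 n λ π → t ^ suc (des π)

  P : ℕ → Carrier → Carrier → Carrier
  P zero      y t = 1#
  P n@(suc _) y t = ∑𝔖 n λ π → y ^ lpk π * t ^ des π

  -- q is the quotient a / b.  In an integral domain there is at most one
  -- such q.
  infix 4 _≐_÷_
  _≐_÷_ : Carrier → Carrier → Carrier → Set ℓ₂
  q ≐ a ÷ b = b ≉ 0# × b * q ≈ a

module Poly[ℚ] = Polynomial ℚ.+-*-commutativeRing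

ℚ[y] : CommutativeRing 0ℓ 0ℓ
ℚ[y] = Poly[ℚ].commutativeRing

ℚ[y]-isIntegralDomain : IsIntegralDomain ℚ[y]
ℚ[y]-isIntegralDomain = Poly[ℚ].isIntegralDomain ℚ-isIntegralDomain

module Poly[ℚ[y]]   = Polynomial ℚ[y]
module Series[ℚ[y]] = PowerSeries ℚ[y]

ℚ[y,t] : CommutativeRing 0ℓ 0ℓ
ℚ[y,t] = Poly[ℚ[y]].commutativeRing

module ℚ[y,t]-Fractions =
  Fractions ℚ[y,t] (Poly[ℚ[y]].isIntegralDomain ℚ[y]-isIntegralDomain)

ℚ⟨y,t⟩ : CommutativeRing 0ℓ 0ℓ
ℚ⟨y,t⟩ = ℚ[y,t]-Fractions.commutativeRing

ℚ[y]⟦t⟧ : CommutativeRing 0ℓ 0ℓ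
ℚ[y]⟦t⟧ = Series[ℚ[y]].commutativeRing

-- The indeterminates in ℚ(y,t), and the two quotients substituted into Pₙ.
module RationalFunctions where
  private
    module Q = CommutativeRing ℚ[y,t]
    open Q using (0#; 1#; _≉_; _+_; _*_)
    open IsIntegralDomain (Poly[ℚ[y]].isIntegralDomain ℚ[y]-isIntegralDomain) using (*-nonzero)
    open Exp Q.commutativeSemiring using (_^_)
    open ℚ[y,t]-Fractions using (Fraction; _/_⟨_⟩; ι)

  yₚ tₚ : Q.Carrier
  yₚ = Poly[ℚ[y]].const Poly[ℚ].X
  tₚ = Poly[ℚ[y]].X

  private
    coefficient : ℕ → ℕ → Q.Carrier → ℚ
    coefficient i j p = Poly[ℚ].coeff (Poly[ℚ[y]].coeff p j) i

    coefficient-cong : ∀ i j {p q} → p Q.≈ q → coefficient i j p ≡ coefficient i j q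
    coefficient-cong i j p≈q =
      Poly[ℚ].coeff-≈ (Poly[ℚ[y]].coeff-≈ p≈q .Series[ℚ[y]].at j) .PowerSeries.at i

  y+t≉0 : yₚ + tₚ ≉ 0#
  y+t≉0 p = contradiction (coefficient-cong 0 1 p) λ ()

  1+yt≉0 : 1# + yₚ * tₚ ≉ 0#
  1+yt≉0 p = contradiction (coefficient-cong 0 0 p) λ ()

  y t : Fraction
  y = ι yₚ
  t = ι tₚ

  [1+y]²t/[y+t][1+yt] [y+t]/[1+yt] : Fraction
  [1+y]²t/[y+t][1+yt] =
    ((1# + yₚ) ^ 2 * tₚ) / ((yₚ + tₚ) * (1# + yₚ * tₚ)) ⟨ *-nonzero y+t≉0 1+yt≉0 ⟩
  [y+t]/[1+yt] = (yₚ + tₚ) / (1# + yₚ * tₚ) ⟨ 1+yt≉0 ⟩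

module FormalSeries where
  y t : Series[ℚ[y]].Series
  y = Series[ℚ[y]].const Poly[ℚ].X
  t = Series[ℚ[y]].X

module Submission where

-- Give π ∈ 𝔖ₙ the weight c^lpk q^(des-lpk) p^(n-lpk-des), with sum Hₙ, and the
-- weight z^(n-1-des) w^(des+1), with sum Eₙ, where p = w + r, z = q + r and
-- c = z w.  Let D be the derivation with D z = D w = D p = D q = c and D r = 0,
-- so that D c = (p + q) c.  Counting the ways to insert the letter n+1 gives
-- Hₙ₊₁ = (p + D) Hₙ and Eₙ₊₁ = (w + D) Eₙ.  As D r = 0, the binomial transform
-- Lₙ = ∑ₖ (n C k) r^(n-k) Eₖ satisfies Lₙ₊₁ = (w + r + D) Lₙ as well, so Hₙ = Lₙ.
-- For z = 1 + y, w = (1 + y) t, r = 1 - t this is the first identity.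
--
-- D need not exist on a given ring, but f(z + εDz, w + εDw, …) = f + ε Df in the
-- dual numbers, so Hₙ = Lₙ is proved by induction on n in all rings at once.
--
-- For the second identity, √Δ, u and v are polynomials in the solution g of
-- g = t (1 - (1 - y) g) (1 + y g).  They satisfy (1 + uv) t = u + v and
-- (1 + uv) (u + v) y = (1 + u)² v, so the first identity applies to (u, v).

open import Defs
open import Algebra.Bundles using (CommutativeRing)
import Algebra.Properties.AbelianGroup as AbelianGroupProperties
import Algebra.Properties.CommutativeMonoid.Mult as CommutativeMult
import Algebra.Properties.CommutativeSemiring.Exp as Exp
import Algebra.Properties.Ring as RingProperties
import Algebra.Properties.Semiring.Mult as Mult
import Algebra.Properties.Semiring.Mult.TCOptimised as Multiple
import Algebra.Properties.Semiring.Sum as Sum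
import Algebra.Solver.Ring as RingSolver
open import Algebra.Solver.Ring.AlmostCommutativeRing using (_-Raw-AlmostCommutative⟶_; fromCommutativeRing)
open import Data.Bool.Base using (Bool; true; false; if_then_else_)
open import Data.Bool.Properties using (T-≡; ¬-not)
open import Data.Fin.Base as Fin using (Fin; toℕ; inject₁; fromℕ)
open import Data.Fin.Properties using (toℕ-inject₁; toℕ-fromℕ; toℕ≤pred[n]; toℕ<n)
open import Data.Integer.Base as ℤ using (ℤ; +_; -[1+_]; _⊖_)
import Data.Integer.Properties as ℤ
open import Data.List.Base using (List; []; _∷_; _++_; map; concatMap; foldr; length)
open import Data.List.Membership.Propositional using (_∈_)
open import Data.List.Properties using (map-∘; length-applyDownFrom)
open import Data.List.Relation.Binary.Permutation.Propositional using (↭-sym)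
open import Data.List.Relation.Binary.Permutation.Propositional.Properties using (All-resp-↭; ↭-length)
open import Data.List.Relation.Unary.All using (All; []; _∷_)
import Data.List.Relation.Unary.All.Properties as All
open import Data.List.Relation.Unary.Any using (here; there)
open import Data.Maybe.Base using (just; nothing)
open import Data.Nat.Base as ℕ using (ℕ; zero; suc; _∸_; _≤_; _<_; _<ᵇ_; s≤s)
open import Data.Nat.Combinatorics using (_C_; nCk+nC[k+1]≡[n+1]C[k+1]; k>n⇒nCk≡0)
import Data.Nat.Properties as ℕ
open import Data.Product.Base using (_×_; _,_; ∃-syntax)
open import Data.Rational.Base using (ℚ)
open import Data.Sum.Base using (inj₁; inj₂)
open import Function.Base using (_∘_)
open import Function.Bundles using (Equivalence)
open import Level using (Level)
open import Relation.Binary.Definitions using (WeaklyDecidable)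
open import Relation.Binary.PropositionalEquality as ≡ using (_≡_)
import Relation.Binary.Reasoning.Setoid as SetoidReasoning
open import Relation.Nullary.Decidable.Core using (yes; no)
open import Relation.Nullary.Negation using (contradiction)

private variable
  a ℓ : Level

-- Ring solver with integer coefficients.

-- With integer coefficients the solver can decide cancellation in every ring,
-- whatever its equality.
module IntegerSolver (R : CommutativeRing a ℓ) where
  private
    open CommutativeRing R hiding (zero)
    open Multiple semiring using (1+×; ×-homo-+; ×1-homo-*) renaming (_×_ to _×′_)
    open RingProperties ring using (-‿distribˡ-*; -‿distribʳ-*; -‿involutive; -0#≈0#)
    open AbelianGroupProperties +-abelianGroup using (⁻¹-∙-comm)
    open SetoidReasoning setoid

    -- With the optimised multiples `1 ×′ 1#` is `1#` itself, so `con (+ 1)` in a solver term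
    -- reduces to `1#`.
    fromℤ : ℤ → Carrier
    fromℤ (+ n)    = n ×′ 1#
    fromℤ -[1+ n ] = - (suc n ×′ 1#)

    fromℤ-⊖ : ∀ m n → fromℤ (m ⊖ n) ≈ m ×′ 1# - n ×′ 1#
    fromℤ-⊖ m       zero    = sym (trans (+-congˡ -0#≈0#) (+-identityʳ _))
    fromℤ-⊖ zero    (suc n) = sym (+-identityˡ _)
    fromℤ-⊖ (suc m) (suc n) = begin
      fromℤ (suc m ⊖ suc n)            ≡⟨ ≡.cong fromℤ (ℤ.[1+m]⊖[1+n]≡m⊖n m n) ⟩
      fromℤ (m ⊖ n)                    ≈⟨ fromℤ-⊖ m n ⟩
      m ×′ 1# - n ×′ 1#                  ≈⟨ +-congʳ (+-identityʳ _) ⟨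
      m ×′ 1# + 0# - n ×′ 1#             ≈⟨ +-congʳ (+-congˡ (-‿inverseʳ 1#)) ⟨
      m ×′ 1# + (1# - 1#) - n ×′ 1#      ≈⟨ +-congʳ (+-assoc _ _ _) ⟨
      m ×′ 1# + 1# - 1# - n ×′ 1#        ≈⟨ +-assoc _ _ _ ⟩
      m ×′ 1# + 1# + (- 1# - n ×′ 1#)    ≈⟨ +-cong (+-comm _ _) (⁻¹-∙-comm 1# (n ×′ 1#)) ⟩
      1# + m ×′ 1# - (1# + n ×′ 1#)      ≈⟨ +-cong (1+× m 1#) (-‿cong (1+× n 1#)) ⟨
      suc m ×′ 1# - suc n ×′ 1#          ∎

    fromℤ-neg : ∀ i → fromℤ (ℤ.- i) ≈ - fromℤ i
    fromℤ-neg (+ zero)  = sym -0#≈0#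
    fromℤ-neg (+ suc n) = refl
    fromℤ-neg -[1+ n ]  = sym (-‿involutive _)

    fromℤ-+ : ∀ i j → fromℤ (i ℤ.+ j) ≈ fromℤ i + fromℤ j
    fromℤ-+ (+ m)    (+ n)    = ×-homo-+ 1# m n
    fromℤ-+ (+ m)    -[1+ n ] = fromℤ-⊖ m (suc n)
    fromℤ-+ -[1+ m ] (+ n)    = trans (fromℤ-⊖ n (suc m)) (+-comm _ _)
    fromℤ-+ -[1+ m ] -[1+ n ] = begin
      - ((2 ℕ.+ (m ℕ.+ n)) ×′ 1#)        ≡⟨ ≡.cong (λ k → - (suc k ×′ 1#)) (ℕ.+-suc m n) ⟨
      - ((suc m ℕ.+ suc n) ×′ 1#)        ≈⟨ -‿cong (×-homo-+ 1# (suc m) (suc n)) ⟩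
      - (suc m ×′ 1# + suc n ×′ 1#)       ≈⟨ ⁻¹-∙-comm _ _ ⟨
      - (suc m ×′ 1#) - suc n ×′ 1#       ∎

    fromℤ-pos* : ∀ m j → fromℤ (+ m ℤ.* j) ≈ m ×′ 1# * fromℤ j
    fromℤ-pos* m (+ n) = begin
      fromℤ (+ m ℤ.* + n)  ≡⟨ ≡.cong fromℤ (ℤ.pos-* m n) ⟨
      (m ℕ.* n) ×′ 1#       ≈⟨ ×1-homo-* m n ⟩
      m ×′ 1# * (n ×′ 1#)    ∎
    fromℤ-pos* m -[1+ n ] = begin
      fromℤ (+ m ℤ.* (ℤ.- (+ suc n)))   ≡⟨ ≡.cong fromℤ (ℤ.neg-distribʳ-* (+ m) (+ suc n)) ⟨
      fromℤ (ℤ.- (+ m ℤ.* + suc n))     ≈⟨ fromℤ-neg (+ m ℤ.* + suc n) ⟩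
      - fromℤ (+ m ℤ.* + suc n)         ≈⟨ -‿cong (fromℤ-pos* m (+ suc n)) ⟩
      - (m ×′ 1# * (suc n ×′ 1#))         ≈⟨ -‿distribʳ-* _ _ ⟩
      m ×′ 1# * - (suc n ×′ 1#)           ∎

    fromℤ-* : ∀ i j → fromℤ (i ℤ.* j) ≈ fromℤ i * fromℤ j
    fromℤ-* (+ m)    j = fromℤ-pos* m j
    fromℤ-* -[1+ m ] j = begin
      fromℤ (ℤ.- (+ suc m) ℤ.* j)   ≡⟨ ≡.cong fromℤ (ℤ.neg-distribˡ-* (+ suc m) j) ⟨
      fromℤ (ℤ.- (+ suc m ℤ.* j))   ≈⟨ fromℤ-neg (+ suc m ℤ.* j) ⟩
      - fromℤ (+ suc m ℤ.* j)       ≈⟨ -‿cong (fromℤ-pos* (suc m) j) ⟩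
      - (suc m ×′ 1# * fromℤ j)      ≈⟨ -‿distribˡ-* _ _ ⟩
      - (suc m ×′ 1#) * fromℤ j      ∎

    homomorphism : ℤ.+-*-rawRing -Raw-AlmostCommutative⟶ fromCommutativeRing R
    homomorphism = record
      { ⟦_⟧    = fromℤ
      ; +-homo = fromℤ-+
      ; *-homo = fromℤ-*
      ; -‿homo = fromℤ-neg
      ; 0-homo = refl
      ; 1-homo = refl
      }

    _≟_ : WeaklyDecidable (λ i j → fromℤ i ≈ fromℤ j)
    i ≟ j with i ℤ.≟ j
    ... | yes ≡.refl = just refl
    ... | no  _      = nothing

  open RingSolver ℤ.+-*-rawRing (fromCommutativeRing R) homomorphism _≟_ public
    using (Polynomial; solve; _:=_; _:+_; _:*_; _:-_; :-_; _:^_; _:×_; con)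

-- Comparison of letters, and letters and length of a permutation.

<⇒<ᵇ≡true : ∀ {m n} → m < n → (m <ᵇ n) ≡ true
<⇒<ᵇ≡true m<n = Equivalence.to T-≡ (ℕ.<⇒<ᵇ m<n)

<⇒>ᵇ≡false : ∀ {m n} → m < n → (n <ᵇ m) ≡ false
<⇒>ᵇ≡false {m} {n} m<n = ¬-not λ n<ᵇm → ℕ.<-asym m<n (ℕ.<ᵇ⇒< n m (Equivalence.from T-≡ n<ᵇm))

∈𝔖⇒All< : ∀ n {π} → π ∈ 𝔖 n → All (_< suc n) π
∈𝔖⇒All< n π∈ = All-resp-↭ (↭-sym (∈𝔖⇒↭ n π∈)) (All.applyDownFrom⁺₁ suc n s≤s)

∈𝔖⇒length : ∀ n {π} → π ∈ 𝔖 n → length π ≡ n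
∈𝔖⇒length n π∈ = ≡.trans (↭-length (∈𝔖⇒↭ n π∈)) (length-applyDownFrom suc n)

-- Finite sums over lists.

module ListSum (R : CommutativeRing a ℓ) where
  open CommutativeRing R
  open SetoidReasoning setoid
  open IntegerSolver R
  private variable
    X Y : Set

  ∑ : (X → Carrier) → List X → Carrier
  ∑ f xs = foldr _+_ 0# (map f xs)

  ∑-cong : ∀ {f g : X → Carrier} xs → (∀ {x} → x ∈ xs → f x ≈ g x) → ∑ f xs ≈ ∑ g xs
  ∑-cong []       f≈g = refl
  ∑-cong (x ∷ xs) f≈g = +-cong (f≈g (here ≡.refl)) (∑-cong xs (f≈g ∘ there))

  ∑-*ˡ : ∀ b (f : X → Carrier) xs → ∑ (λ x → b * f x) xs ≈ b * ∑ f xs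
  ∑-*ˡ b f []       = sym (zeroʳ b)
  ∑-*ˡ b f (x ∷ xs) = trans (+-congˡ (∑-*ˡ b f xs)) (sym (distribˡ _ _ _))

  ∑-+ : ∀ (f g : X → Carrier) xs → ∑ (λ x → f x + g x) xs ≈ ∑ f xs + ∑ g xs
  ∑-+ f g []       = sym (+-identityˡ 0#)
  ∑-+ f g (x ∷ xs) = trans (+-congˡ (∑-+ f g xs))
    (solve 4 (λ a b c d → (a :+ b) :+ (c :+ d) := (a :+ c) :+ (b :+ d)) refl (f x) (g x) (∑ f xs) (∑ g xs))

  ∑-map : ∀ (f : Y → Carrier) (g : X → Y) xs → ∑ f (map g xs) ≈ ∑ (f ∘ g) xs
  ∑-map f g xs = reflexive (≡.cong (foldr _+_ 0#) (≡.sym (map-∘ xs)))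

  ∑-++ : ∀ (f : X → Carrier) xs ys → ∑ f (xs ++ ys) ≈ ∑ f xs + ∑ f ys
  ∑-++ f []       ys = sym (+-identityˡ _)
  ∑-++ f (x ∷ xs) ys = trans (+-congˡ (∑-++ f xs ys)) (sym (+-assoc _ _ _))

  ∑-concatMap : ∀ (f : Y → Carrier) (g : X → List Y) xs →
                ∑ f (concatMap g xs) ≈ ∑ (λ x → ∑ f (g x)) xs
  ∑-concatMap f g []       = refl
  ∑-concatMap f g (x ∷ xs) = trans (∑-++ f (g x) (concatMap g xs)) (+-congˡ (∑-concatMap f g xs))

-- Multiplicative weights of permutations.

module Weights (R : CommutativeRing a ℓ) where
  open CommutativeRing R

  -- fall a π and rise a π are the weights contributed by the letters π following
  -- a, when a was reached by a descent or by an ascent.  An ascent is weighed only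
  -- together with the next letter, as a descent after it gives a left peak, of
  -- weight c.  The last clause of step, for equal neighbours, never applies to a
  -- permutation.
  module Peaks (p q c : Carrier) where
    fall rise : ℕ → List ℕ → Carrier
    step : Bool → Bool → ℕ → List ℕ → Carrier
    fall a []      = 1#
    fall a (b ∷ π) = step (b <ᵇ a) (a <ᵇ b) b π
    rise a []      = p
    rise a (b ∷ π) = if b <ᵇ a then c * fall b π else p * step false (a <ᵇ b) b π
    step true  _     b π = q * fall b π
    step false true  b π = rise b π
    step false false b π = p * fall b π

    -- The first letter counts as reached by an ascent, so a descent right after it makes a left
    -- peak in position 1.
    peakWeight : List ℕ → Carrier
    peakWeight []      = 1#
    peakWeight (b ∷ π) = rise b π

  module Descents (z w : Carrier) where
    steps : ℕ → List ℕ → Carrier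
    steps a []      = 1#
    steps a (b ∷ π) = (if b <ᵇ a then w else z) * steps b π

    -- The `w` of the first letter accounts for the extra 1 in the exponent `des + 1` of the
    -- Eulerian polynomials.
    desWeight : List ℕ → Carrier
    desWeight []      = 1#
    desWeight (b ∷ π) = w * steps b π

-- Dual numbers as a source of derivations.

module DualNumbers (R : CommutativeRing a ℓ) where
  open CommutativeRing R hiding (zero)
  open SetoidReasoning setoid

  -- Only the coefficients of 1 and ε are ever read, so ε² = 0 need not be imposed.
  R[ε] : CommutativeRing a ℓ
  R[ε] = PowerSeries.commutativeRing R

  module R[ε] = CommutativeRing R[ε]
  open PowerSeries R using (Series)

  infix 6 _+ε_
  _+ε_ : Carrier → Carrier → Series
  (a +ε b) 0 = a
  (a +ε b) 1 = b
  (a +ε b) _ = 0#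

  *-at0 : ∀ f g → (f R[ε].* g) 0 ≈ f 0 * g 0
  *-at0 f g = +-identityʳ _

  -- The Leibniz rule for the coefficient of ε.
  *-at1 : ∀ f g → (f R[ε].* g) 1 ≈ f 0 * g 1 + f 1 * g 0
  *-at1 f g = +-congˡ (+-identityʳ _)

  *-at1-by : ∀ f g {f₀ f₁ g₀ g₁} → f 0 ≈ f₀ → f 1 ≈ f₁ → g 0 ≈ g₀ → g 1 ≈ g₁ →
             (f R[ε].* g) 1 ≈ f₀ * g₁ + f₁ * g₀
  *-at1-by f g e₁ e₂ e₃ e₄ = trans (*-at1 f g) (+-cong (*-cong e₁ e₄) (*-cong e₂ e₃))

-- Insertion of a new largest letter.

module Insertion (R : CommutativeRing a ℓ) where
  open CommutativeRing R hiding (zero)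
  open SetoidReasoning setoid
  open DualNumbers R
  open ListSum R
  open IntegerSolver R
  private
    module W = Weights R
    module Wε = Weights R[ε]

  -- The hypotheses encode `D p = D q = c` and `D c = (p + q) c`, so the coefficient of ε in a
  -- hatted weight is `D` of that weight. Only two coefficients are prescribed because `ĉ` will be a
  -- product, whose coefficient of ε² need not vanish.
  module PeakInsertion (p q c : Carrier) (p̂ q̂ ĉ : R[ε].Carrier)
    (p̂₀ : p̂ 0 ≈ p) (p̂₁ : p̂ 1 ≈ c) (q̂₀ : q̂ 0 ≈ q) (q̂₁ : q̂ 1 ≈ c)
    (ĉ₀ : ĉ 0 ≈ c) (ĉ₁ : ĉ 1 ≈ (p + q) * c) where
    open W.Peaks p q c
    private module ε = Wε.Peaks p̂ q̂ ĉ

    fall₀ : ∀ a π → ε.fall a π 0 ≈ fall a π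
    rise₀ : ∀ a π → ε.rise a π 0 ≈ rise a π
    step₀ : ∀ e e′ b π → ε.step e e′ b π 0 ≈ step e e′ b π
    fall₀ a []      = refl
    fall₀ a (b ∷ π) = step₀ (b <ᵇ a) (a <ᵇ b) b π
    rise₀ a [] = p̂₀
    rise₀ a (b ∷ π) with b <ᵇ a
    ... | true  = trans (*-at0 ĉ (ε.fall b π)) (*-cong ĉ₀ (fall₀ b π))
    ... | false = trans (*-at0 p̂ (ε.step false (a <ᵇ b) b π)) (*-cong p̂₀ (step₀ false (a <ᵇ b) b π))
    step₀ true  _     b π = trans (*-at0 q̂ (ε.fall b π)) (*-cong q̂₀ (fall₀ b π))
    step₀ false true  b π = rise₀ b π
    step₀ false false b π = trans (*-at0 p̂ (ε.fall b π)) (*-cong p̂₀ (fall₀ b π))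

    module _ {x : ℕ} where
      fall-x : ∀ {a} π → a < x → fall a (x ∷ π) ≈ rise x π
      fall-x π a<x rewrite <⇒>ᵇ≡false a<x | <⇒<ᵇ≡true a<x = refl

      rise-x : ∀ {a} π → a < x → rise a (x ∷ π) ≈ p * rise x π
      rise-x π a<x rewrite <⇒>ᵇ≡false a<x | <⇒<ᵇ≡true a<x = refl

      x-rise : ∀ {b} π → b < x → rise x (b ∷ π) ≈ c * fall b π
      x-rise π b<x rewrite <⇒<ᵇ≡true b<x = refl

      -- Inserting `x` at the end gives a factor `p`. Any other place changes one factor of the
      -- weight: a `p` or `q` becomes `c`, and the places before and after a left peak turn its `c`
      -- into `q c` and `p c`. These changes add up to the derivative.
      ∑-insertions-fall : ∀ {a} π → a < x → All (_< x) π →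
        ∑ (fall a) (insertions x π) ≈ p * fall a π + ε.fall a π 1
      -- The summand c * fall a π comes from inserting x just before a.
      ∑-insertions-rise : ∀ {a} π → a < x → All (_< x) π →
        ∑ (rise a) (insertions x π) + c * fall a π ≈ p * rise a π + ε.rise a π 1
      -- The summand `c * fall b π` comes from inserting `x` just before `b`. This form serves
      -- `fall` and also the case of `rise` without a descent.
      ∑-insertions-step : ∀ e e′ {b} π → b < x → All (_< x) π →
        c * fall b π + ∑ (step e e′ b) (insertions x π) ≈ p * step e e′ b π + ε.step e e′ b π 1

      -- Treats together the factor `q` of a descent and the factor `p` of equal neighbours, as both
      -- have derivative `c`.
      ∑-insertions-scaled : ∀ {s} ŝ → ŝ 0 ≈ s → ŝ 1 ≈ c → ∀ {b} π → b < x → All (_< x) π →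
        c * fall b π + ∑ (λ σ → s * fall b σ) (insertions x π)
          ≈ p * (s * fall b π) + (ŝ R[ε].* ε.fall b π) 1

      ∑-insertions-fall {a} [] a<x _ = begin
        fall a (x ∷ []) + 0#  ≈⟨ +-identityʳ _ ⟩
        fall a (x ∷ [])       ≈⟨ fall-x [] a<x ⟩
        p                     ≈⟨ *-identityʳ p ⟨
        p * 1#                ≈⟨ +-identityʳ _ ⟨
        p * 1# + 0#           ∎
      ∑-insertions-fall {a} (b ∷ π) a<x (b<x ∷ π<x) = begin
        fall a (x ∷ b ∷ π) + ∑ (fall a) (map (b ∷_) (insertions x π))
          ≈⟨ +-cong (trans (fall-x (b ∷ π) a<x) (x-rise π b<x))
               (∑-map (fall a) (b ∷_) (insertions x π)) ⟩
        c * fall b π + ∑ (step (b <ᵇ a) (a <ᵇ b) b) (insertions x π)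
          ≈⟨ ∑-insertions-step (b <ᵇ a) (a <ᵇ b) π b<x π<x ⟩
        p * fall a (b ∷ π) + ε.fall a (b ∷ π) 1 ∎

      ∑-insertions-rise {a} [] a<x _ = begin
        rise a (x ∷ []) + 0# + c * 1#  ≈⟨ +-cong (trans (+-identityʳ _) (rise-x [] a<x)) (*-identityʳ c) ⟩
        p * p + c                      ≈⟨ +-congˡ p̂₁ ⟨
        p * p + p̂ 1                    ∎
      ∑-insertions-rise {a} (b ∷ π) a<x (b<x ∷ π<x) = begin
        rise a (x ∷ b ∷ π) + ∑ (rise a) (map (b ∷_) (insertions x π)) + c * fall a (b ∷ π)
          ≈⟨ +-congʳ (+-cong (trans (rise-x (b ∷ π) a<x) (*-congˡ (x-rise π b<x)))
               (∑-map (rise a) (b ∷_) (insertions x π))) ⟩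
        p * (c * fall b π) + ∑ (λ σ → rise a (b ∷ σ)) (insertions x π) + c * fall a (b ∷ π)
          ≈⟨ rest ⟩
        p * rise a (b ∷ π) + ε.rise a (b ∷ π) 1 ∎
        where
        F  = fall b π
        F′ = ε.fall b π 1
        rest : p * (c * F) + ∑ (λ σ → rise a (b ∷ σ)) (insertions x π) + c * fall a (b ∷ π)
                 ≈ p * rise a (b ∷ π) + ε.rise a (b ∷ π) 1
        rest with b <ᵇ a
        -- Here `a` is a left peak: the places just before and just after it contribute `q c` and
        -- `p c`, which make up `D c`.
        ... | true = begin
          p * (c * F) + ∑ (λ σ → c * fall b σ) (insertions x π) + c * (q * F)
            ≈⟨ +-congʳ (+-congˡ (trans (∑-*ˡ c (fall b) (insertions x π))
                 (*-congˡ (∑-insertions-fall π b<x π<x)))) ⟩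
          p * (c * F) + c * (p * F + F′) + c * (q * F)
            ≈⟨ solve 5 (λ p q c F F′ → p :* (c :* F) :+ c :* (p :* F :+ F′) :+ c :* (q :* F)
                   := p :* (c :* F) :+ (c :* F′ :+ (p :+ q) :* c :* F)) refl p q c F F′ ⟩
          p * (c * F) + (c * F′ + (p + q) * c * F)
            ≈⟨ +-congˡ (*-at1-by ĉ (ε.fall b π) ĉ₀ ĉ₁ (fall₀ b π) refl) ⟨
          p * (c * F) + (ĉ R[ε].* ε.fall b π) 1 ∎
        ... | false = begin
          p * (c * F) + ∑ (λ σ → p * step false (a <ᵇ b) b σ) (insertions x π) + c * G
            ≈⟨ +-congʳ (+-congˡ (∑-*ˡ p (step false (a <ᵇ b) b) (insertions x π))) ⟩
          p * (c * F) + p * ∑ (step false (a <ᵇ b) b) (insertions x π) + c * G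
            ≈⟨ +-congʳ (sym (distribˡ p _ _)) ⟩
          p * (c * F + ∑ (step false (a <ᵇ b) b) (insertions x π)) + c * G
            ≈⟨ +-congʳ (*-congˡ (∑-insertions-step false (a <ᵇ b) π b<x π<x)) ⟩
          p * (p * G + G′) + c * G
            ≈⟨ solve 4 (λ p c G G′ → p :* (p :* G :+ G′) :+ c :* G := p :* (p :* G) :+ (p :* G′ :+ c :* G))
                 refl p c G G′ ⟩
          p * (p * G) + (p * G′ + c * G)
            ≈⟨ +-congˡ (*-at1-by p̂ (ε.step false (a <ᵇ b) b π)
                 p̂₀ p̂₁ (step₀ false (a <ᵇ b) b π) refl) ⟨
          p * (p * G) + (p̂ R[ε].* ε.step false (a <ᵇ b) b π) 1 ∎
          where
          G  = step false (a <ᵇ b) b π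
          G′ = ε.step false (a <ᵇ b) b π 1

      ∑-insertions-step false true  π b<x π<x = trans (+-comm _ _) (∑-insertions-rise π b<x π<x)
      ∑-insertions-step true  _     {b} π b<x π<x =
        ∑-insertions-scaled q̂ q̂₀ q̂₁ π b<x π<x
      ∑-insertions-step false false {b} π b<x π<x =
        ∑-insertions-scaled p̂ p̂₀ p̂₁ π b<x π<x

      ∑-insertions-scaled {s} ŝ ŝ₀ ŝ₁ {b} π b<x π<x = begin
        c * F + ∑ (λ σ → s * fall b σ) (insertions x π)
          ≈⟨ +-congˡ (trans (∑-*ˡ s (fall b) (insertions x π)) (*-congˡ (∑-insertions-fall π b<x π<x))) ⟩
        c * F + s * (p * F + F′)
          ≈⟨ solve 5 (λ p s c F F′ → c :* F :+ s :* (p :* F :+ F′) := p :* (s :* F) :+ (s :* F′ :+ c :* F))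
               refl p s c F F′ ⟩
        p * (s * F) + (s * F′ + c * F)
          ≈⟨ +-congˡ (*-at1-by ŝ (ε.fall b π) ŝ₀ ŝ₁ (fall₀ b π) refl) ⟨
        p * (s * F) + (ŝ R[ε].* ε.fall b π) 1 ∎
        where
        F  = fall b π
        F′ = ε.fall b π 1

      ∑-insertions-peakWeight : ∀ π → All (_< x) π →
        ∑ peakWeight (insertions x π) ≈ p * peakWeight π + ε.peakWeight π 1
      ∑-insertions-peakWeight [] _ = begin
        p + 0#       ≈⟨ +-congʳ (*-identityʳ p) ⟨
        p * 1# + 0#  ∎
      ∑-insertions-peakWeight (b ∷ π) (b<x ∷ π<x) = begin
        rise x (b ∷ π) + ∑ peakWeight (map (b ∷_) (insertions x π))
          ≈⟨ +-cong (x-rise π b<x) (∑-map peakWeight (b ∷_) (insertions x π)) ⟩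
        c * fall b π + ∑ (rise b) (insertions x π)
          ≈⟨ +-comm _ _ ⟩
        ∑ (rise b) (insertions x π) + c * fall b π
          ≈⟨ ∑-insertions-rise π b<x π<x ⟩
        p * rise b π + ε.rise b π 1 ∎

  module DescentInsertion (z w : Carrier) (ẑ ŵ : R[ε].Carrier)
    (ẑ₀ : ẑ 0 ≈ z) (ẑ₁ : ẑ 1 ≈ z * w) (ŵ₀ : ŵ 0 ≈ w) (ŵ₁ : ŵ 1 ≈ z * w) where
    open W.Descents z w
    private module ε = Wε.Descents ẑ ŵ

    steps₀ : ∀ a π → ε.steps a π 0 ≈ steps a π
    steps₀ a [] = refl
    steps₀ a (b ∷ π) with b <ᵇ a
    ... | true  = trans (*-at0 ŵ (ε.steps b π)) (*-cong ŵ₀ (steps₀ b π))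
    ... | false = trans (*-at0 ẑ (ε.steps b π)) (*-cong ẑ₀ (steps₀ b π))

    module _ {x : ℕ} where
      steps-x : ∀ {a} π → a < x → steps a (x ∷ π) ≈ z * steps x π
      steps-x π a<x rewrite <⇒>ᵇ≡false a<x = refl

      x-steps : ∀ {b} π → b < x → steps x (b ∷ π) ≈ w * steps b π
      x-steps π b<x rewrite <⇒<ᵇ≡true b<x = refl

      -- At the end `x` adds an ascent, of factor `z`; at any other place a factor `z` or `w`
      -- becomes `z * w`, its derivative.
      ∑-insertions-steps : ∀ {a} π → a < x → All (_< x) π →
        ∑ (steps a) (insertions x π) ≈ z * steps a π + ε.steps a π 1
      ∑-insertions-steps {a} [] a<x _ = +-congʳ (steps-x {a} [] a<x)
      ∑-insertions-steps {a} (b ∷ π) a<x (b<x ∷ π<x) = begin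
        steps a (x ∷ b ∷ π) + ∑ (steps a) (map (b ∷_) (insertions x π))
          ≈⟨ +-cong (trans (steps-x (b ∷ π) a<x) (*-congˡ (x-steps π b<x)))
               (∑-map (steps a) (b ∷_) (insertions x π)) ⟩
        z * (w * S) + ∑ (λ σ → steps a (b ∷ σ)) (insertions x π)
          ≈⟨ rest ⟩
        z * steps a (b ∷ π) + ε.steps a (b ∷ π) 1 ∎
        where
        S  = steps b π
        S′ = ε.steps b π 1
        scaled : ∀ {s} ŝ → ŝ 0 ≈ s → ŝ 1 ≈ z * w →
          z * (w * S) + ∑ (λ σ → s * steps b σ) (insertions x π)
            ≈ z * (s * S) + (ŝ R[ε].* ε.steps b π) 1
        scaled {s} ŝ ŝ₀ ŝ₁ = begin
          z * (w * S) + ∑ (λ σ → s * steps b σ) (insertions x π)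
            ≈⟨ +-congˡ (trans (∑-*ˡ s (steps b) (insertions x π)) (*-congˡ (∑-insertions-steps π b<x π<x))) ⟩
          z * (w * S) + s * (z * S + S′)
            ≈⟨ solve 5 (λ z w s S S′ → z :* (w :* S) :+ s :* (z :* S :+ S′)
                   := z :* (s :* S) :+ (s :* S′ :+ z :* w :* S)) refl z w s S S′ ⟩
          z * (s * S) + (s * S′ + z * w * S)
            ≈⟨ +-congˡ (*-at1-by ŝ (ε.steps b π) ŝ₀ ŝ₁ (steps₀ b π) refl) ⟨
          z * (s * S) + (ŝ R[ε].* ε.steps b π) 1 ∎
        rest : z * (w * S) + ∑ (λ σ → steps a (b ∷ σ)) (insertions x π)
                 ≈ z * steps a (b ∷ π) + ε.steps a (b ∷ π) 1
        rest with b <ᵇ a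
        ... | true  = scaled ŵ ŵ₀ ŵ₁
        ... | false = scaled ẑ ẑ₀ ẑ₁

      -- At the front `x` adds a descent, a factor `w` on the whole weight. The place at the end, of
      -- factor `z`, supplies the derivative `z * w` of the leading `w`.
      ∑-insertions-desWeight : ∀ π → All (_< x) π →
        ∑ desWeight (insertions x π) ≈ w * desWeight π + ε.desWeight π 1
      ∑-insertions-desWeight [] _ = refl
      ∑-insertions-desWeight (b ∷ π) (b<x ∷ π<x) = begin
        w * steps x (b ∷ π) + ∑ desWeight (map (b ∷_) (insertions x π))
          ≈⟨ +-cong (*-congˡ (x-steps π b<x)) (trans (∑-map desWeight (b ∷_) (insertions x π))
               (trans (∑-*ˡ w (steps b) (insertions x π)) (*-congˡ (∑-insertions-steps π b<x π<x)))) ⟩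
        w * (w * S) + w * (z * S + S′)
          ≈⟨ solve 4 (λ z w S S′ → w :* (w :* S) :+ w :* (z :* S :+ S′)
                 := w :* (w :* S) :+ (w :* S′ :+ z :* w :* S)) refl z w S S′ ⟩
        w * (w * S) + (w * S′ + z * w * S)
          ≈⟨ +-congˡ (*-at1-by ŵ (ε.steps b π) ŵ₀ ŵ₁ (steps₀ b π) refl) ⟨
        w * (w * S) + (ŵ R[ε].* ε.steps b π) 1 ∎
        where
        S  = steps b π
        S′ = ε.steps b π 1

-- Binomial transform.

module BinomialTransform (R : CommutativeRing a ℓ) where
  open Eulerian R
  open Exp commutativeSemiring using (^-congʳ)
  open Mult semiring using (×-homo-+; ×-congʳ; ×-comm-*; ×-cong)
  open Sum semiring hiding (sum⁺-syntax)
  open SetoidReasoning setoid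
  open IntegerSolver R

  summand : Carrier → (ℕ → Carrier) → ℕ → ℕ → Carrier
  summand r a n k = (n C k) · (r ^ (n ∸ k) * a k)

  transform : Carrier → (ℕ → Carrier) → ℕ → Carrier
  transform r a n = ∑[ k ≤ n ] summand r a n (toℕ k)

  -- Pascal's rule splits each term with positive index into a term of the shifted sequence and a
  -- term with one more factor `r`.
  transform-suc : ∀ r a n → transform r a (suc n) ≈ r * transform r a n + transform r (a ∘ suc) n
  transform-suc r a n = begin
    term₀ + ∑[ i ≤ n ] ((suc n C suc (toℕ i)) · b i)
      ≈⟨ +-congˡ (sum-cong-≋ {suc n} pascal) ⟩
    term₀ + ∑[ i ≤ n ] ((n C toℕ i) · b i + (n C suc (toℕ i)) · b i)
      ≈⟨ +-congˡ (∑-distrib-+ {suc n} (λ i → (n C toℕ i) · b i) (λ i → (n C suc (toℕ i)) · b i)) ⟩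
    term₀ + (transform r (a ∘ suc) n + ∑[ i ≤ n ] ((n C suc (toℕ i)) · b i))
      ≈⟨ solve 3 (λ x y z → x :+ (y :+ z) := (x :+ z) :+ y) refl term₀ (transform r (a ∘ suc) n) _ ⟩
    term₀ + ∑[ i ≤ n ] ((n C suc (toℕ i)) · b i) + transform r (a ∘ suc) n
      ≈⟨ +-congʳ lower ⟩
    r * transform r a n + transform r (a ∘ suc) n ∎
    where
    b : Fin (suc n) → Carrier
    b i = r ^ (n ∸ toℕ i) * a (suc (toℕ i))
    term₀ = (suc n C 0) · (r ^ suc n * a 0)
    pascal : ∀ i → (suc n C suc (toℕ i)) · b i ≈ (n C toℕ i) · b i + (n C suc (toℕ i)) · b i
    pascal i = begin
      (suc n C suc (toℕ i)) · b i
        ≡⟨ ≡.cong (_· b i) (nCk+nC[k+1]≡[n+1]C[k+1] n (toℕ i)) ⟨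
      ((n C toℕ i) ℕ.+ (n C suc (toℕ i))) · b i
        ≈⟨ ×-homo-+ (b i) (n C toℕ i) (n C suc (toℕ i)) ⟩
      (n C toℕ i) · b i + (n C suc (toℕ i)) · b i ∎
    raised : ℕ → Carrier
    raised k = (n C k) · (r ^ (suc n ∸ k) * a k)
    raised≈ : ∀ {k} → k ≤ n → raised k ≈ r * summand r a n k
    raised≈ {k} k≤n = begin
      (n C k) · (r ^ (suc n ∸ k) * a k)
        ≈⟨ ×-congʳ (n C k) (*-congʳ (^-congʳ r (ℕ.+-∸-assoc 1 k≤n))) ⟩
      (n C k) · (r * r ^ (n ∸ k) * a k)
        ≈⟨ ×-congʳ (n C k) (*-assoc r _ _) ⟩
      (n C k) · (r * (r ^ (n ∸ k) * a k))
        ≈⟨ ×-comm-* (n C k) r _ ⟨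
      r * summand r a n k ∎
    -- The first term of this sum is `term₀`, and its last vanishes because `n C suc n` is 0.
    lower : ∑[ i ≤ suc n ] raised (toℕ i) ≈ r * transform r a n
    lower = begin
      ∑[ i ≤ suc n ] raised (toℕ i)
        ≈⟨ sum-init-last {suc n} (λ i → raised (toℕ i)) ⟩
      ∑[ i ≤ n ] raised (toℕ (inject₁ i)) + raised (toℕ (fromℕ (suc n)))
        ≈⟨ +-cong (sum-cong-≋ {suc n} λ i →
                    trans (reflexive (≡.cong raised (toℕ-inject₁ i))) (raised≈ (toℕ≤pred[n] i)))
                  (trans (reflexive (≡.cong raised (toℕ-fromℕ (suc n))))
                    (×-cong (k>n⇒nCk≡0 (ℕ.n<1+n n)) refl)) ⟩
      ∑[ i ≤ n ] (r * summand r a n (toℕ i)) + 0#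
        ≈⟨ +-identityʳ _ ⟩
      ∑[ i ≤ n ] (r * summand r a n (toℕ i))
        ≈⟨ *-distribˡ-sum {suc n} r (λ i → summand r a n (toℕ i)) ⟨
      r * transform r a n ∎

-- Generating functions and their common recurrence.

module GeneratingFunctions (R : CommutativeRing a ℓ) where
  open Eulerian R using (Carrier; ∑𝔖)

  H : (p q c : Carrier) → ℕ → Carrier
  H p q c n = ∑𝔖 n (Weights.Peaks.peakWeight R p q c)

  E : (z w : Carrier) → ℕ → Carrier
  E z w n = ∑𝔖 n (Weights.Descents.desWeight R z w)

module Recurrences (R : CommutativeRing a ℓ) where
  open Eulerian R
  open Mult semiring using (×-congʳ; ×-comm-*)
  open CommutativeMult +-commutativeMonoid using (×-distrib-+)
  open Sum semiring hiding (sum⁺-syntax)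
  open SetoidReasoning setoid
  open ListSum R
  open DualNumbers R
  open GeneratingFunctions R
  open BinomialTransform R
  open IntegerSolver R
  private
    module ε where
      open ListSum R[ε] public using (∑)
      open Eulerian R[ε] public using (sum⁺-syntax; _·_; _^_)
      open GeneratingFunctions R[ε] public
      open BinomialTransform R[ε] public using (transform; summand)
      open Sum R[ε].semiring public using (sum)

  ∑-at : ∀ i {X : Set} (f : X → R[ε].Carrier) xs → ε.∑ f xs i ≈ ∑ (λ x → f x i) xs
  ∑-at i f []       = refl
  ∑-at i f (x ∷ xs) = +-congˡ (∑-at i f xs)

  sum-at : ∀ i {n} (f : Fin n → R[ε].Carrier) → ε.sum f i ≈ sum (λ k → f k i)
  sum-at i {zero}  f = refl
  sum-at i {suc n} f = +-congˡ (sum-at i (f ∘ Fin.suc))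

  ·-at : ∀ i n f → (n ε.· f) i ≈ n · f i
  ·-at i zero    f = refl
  ·-at i (suc n) f = +-congˡ (·-at i n f)

  -- Turns an insertion formula for single permutations into a recurrence of the form `(s + D)` for
  -- their sum.
  ∑𝔖-insertions : ∀ n s (f : List ℕ → Carrier) (f̂ : List ℕ → R[ε].Carrier) →
    (∀ {π} → π ∈ 𝔖 n → ∑ f (insertions (suc n) π) ≈ s * f π + f̂ π 1) →
    ∑ f (𝔖 (suc n)) ≈ s * ∑ f (𝔖 n) + ε.∑ f̂ (𝔖 n) 1
  ∑𝔖-insertions n s f f̂ insert = begin
    ∑ f (𝔖 (suc n))
      ≈⟨ ∑-concatMap f (insertions (suc n)) (𝔖 n) ⟩
    ∑ (λ π → ∑ f (insertions (suc n) π)) (𝔖 n)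
      ≈⟨ ∑-cong (𝔖 n) insert ⟩
    ∑ (λ π → s * f π + f̂ π 1) (𝔖 n)
      ≈⟨ ∑-+ (λ π → s * f π) (λ π → f̂ π 1) (𝔖 n) ⟩
    ∑ (λ π → s * f π) (𝔖 n) + ∑ (λ π → f̂ π 1) (𝔖 n)
      ≈⟨ +-cong (∑-*ˡ s f (𝔖 n)) (sym (∑-at 1 f̂ (𝔖 n))) ⟩
    s * ∑ f (𝔖 n) + ε.∑ f̂ (𝔖 n) 1 ∎

  -- As `D r = 0`, powers of `r̂` have no ε part, so `D` passes through the transform to the
  -- sequence.
  transform-at1 : ∀ r r̂ â n → r̂ 0 ≈ r → r̂ 1 ≈ 0# →
                  ε.transform r̂ â n 1 ≈ transform r (λ k → â k 1) n
  transform-at1 r r̂ â n r̂₀ r̂₁ = trans (sum-at 1 {suc n} (λ k → ε.summand r̂ â n (toℕ k)))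
    (sum-cong-≋ {suc n} λ k → summand-at1 (toℕ k))
    where
    ^-at0 : ∀ m → (r̂ ε.^ m) 0 ≈ r ^ m
    ^-at0 zero    = refl
    ^-at0 (suc m) = trans (*-at0 r̂ (r̂ ε.^ m)) (*-cong r̂₀ (^-at0 m))
    ^-at1 : ∀ m → (r̂ ε.^ m) 1 ≈ 0#
    ^-at1 zero    = refl
    ^-at1 (suc m) = begin
      (r̂ ε.^ suc m) 1      ≈⟨ *-at1-by r̂ (r̂ ε.^ m) r̂₀ r̂₁ (^-at0 m) (^-at1 m) ⟩
      r * 0# + 0# * r ^ m  ≈⟨ +-cong (zeroʳ _) (zeroˡ _) ⟩
      0# + 0#              ≈⟨ +-identityˡ 0# ⟩
      0#                   ∎
    summand-at1 : ∀ k → ε.summand r̂ â n k 1 ≈ summand r (λ k → â k 1) n k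
    summand-at1 k = trans (·-at 1 (n C k) (r̂ ε.^ (n ∸ k) R[ε].* â k)) (×-congʳ (n C k) (begin
      (r̂ ε.^ (n ∸ k) R[ε].* â k) 1
        ≈⟨ *-at1-by (r̂ ε.^ (n ∸ k)) (â k) (^-at0 (n ∸ k)) (^-at1 (n ∸ k)) refl refl ⟩
      r ^ (n ∸ k) * â k 1 + 0# * â k 0
        ≈⟨ trans (+-congˡ (zeroˡ _)) (+-identityʳ _) ⟩
      r ^ (n ∸ k) * â k 1 ∎))

  transform-linear : ∀ r s b d n →
    transform r (λ k → s * b k + d k) n ≈ s * transform r b n + transform r d n
  transform-linear r s b d n = begin
    transform r (λ k → s * b k + d k) n
      ≈⟨ sum-cong-≋ {suc n} (λ k → term (n C toℕ k) (r ^ (n ∸ toℕ k)) (b (toℕ k)) (d (toℕ k))) ⟩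
    ∑[ k ≤ n ] (s * summand r b n (toℕ k) + summand r d n (toℕ k))
      ≈⟨ ∑-distrib-+ {suc n} (λ k → s * summand r b n (toℕ k)) (λ k → summand r d n (toℕ k)) ⟩
    ∑[ k ≤ n ] (s * summand r b n (toℕ k)) + transform r d n
      ≈⟨ +-congʳ (*-distribˡ-sum {suc n} s (λ k → summand r b n (toℕ k))) ⟨
    s * transform r b n + transform r d n ∎
    where
    term : ∀ m x y y′ → m · (x * (s * y + y′)) ≈ s * (m · (x * y)) + m · (x * y′)
    term m x y y′ = begin
      m · (x * (s * y + y′))
        ≈⟨ ×-congʳ m (solve 4 (λ s x y y′ → x :* (s :* y :+ y′) := s :* (x :* y) :+ x :* y′) refl s x y y′) ⟩
      m · (s * (x * y) + x * y′)
        ≈⟨ ×-distrib-+ (s * (x * y)) (x * y′) m ⟩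
      m · (s * (x * y)) + m · (x * y′)
        ≈⟨ +-congʳ (×-comm-* m s (x * y)) ⟨
      s * (m · (x * y)) + m · (x * y′) ∎

  -- Both sides grow by the operator `w + r + D`. The hypothesis over `R[ε]`, read at the
  -- coefficient of ε, equates the two derivatives.
  H≈transform-E-suc : ∀ n →
    (∀ {p q c z w r} → p R[ε].≈ w R[ε].+ r → z R[ε].≈ q R[ε].+ r → c R[ε].≈ z R[ε].* w →
     ε.H p q c n R[ε].≈ ε.transform r (ε.E z w) n) →
    ∀ {p q c z w r} → p ≈ w + r → z ≈ q + r → c ≈ z * w →
    H p q c n ≈ transform r (E z w) n →
    H p q c (suc n) ≈ transform r (E z w) (suc n)
  H≈transform-E-suc n IH {p} {q} {c} {z} {w} {r} p≈ z≈ c≈ H≈L = begin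
    H p q c (suc n)
      ≈⟨ ∑𝔖-insertions n p _ _ (λ π∈ → PI.∑-insertions-peakWeight _ (∈𝔖⇒All< n π∈)) ⟩
    p * H p q c n + ε.H p̂ q̂ ĉ n 1
      ≈⟨ +-cong (*-cong p≈ H≈L)
           (PowerSeries.at (IH {p̂} {q̂} {ĉ} {ẑ} {ŵ} {r̂} R[ε].refl R[ε].refl R[ε].refl) 1) ⟩
    (w + r) * L + ε.transform r̂ (ε.E ẑ ŵ) n 1
      ≈⟨ +-congˡ (transform-at1 r r̂ (ε.E ẑ ŵ) n refl refl) ⟩
    (w + r) * L + transform r (λ k → ε.E ẑ ŵ k 1) n
      ≈⟨ solve 4 (λ w r L L′ → (w :+ r) :* L :+ L′ := r :* L :+ (w :* L :+ L′)) refl w r L _ ⟩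
    r * L + (w * L + transform r (λ k → ε.E ẑ ŵ k 1) n)
      ≈⟨ +-congˡ (transform-linear r w (E z w) (λ k → ε.E ẑ ŵ k 1) n) ⟨
    r * L + transform r (λ k → w * E z w k + ε.E ẑ ŵ k 1) n
      ≈⟨ +-congˡ (sum-cong-≋ {suc n} λ k →
           ×-congʳ (n C toℕ k) (*-congˡ {r ^ (n ∸ toℕ k)} (E-suc (toℕ k)))) ⟨
    r * L + transform r (E z w ∘ suc) n
      ≈⟨ transform-suc r (E z w) n ⟨
    transform r (E z w) (suc n) ∎
    where
    L = transform r (E z w) n
    -- Only `q`, `w` and `r` are perturbed freely. Defining `p̂`, `ẑ` and `ĉ` by the three relations
    -- makes these hold by reflexivity over `R[ε]`.
    q̂ = q +ε c
    ŵ = w +ε c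
    r̂ = r +ε 0#
    p̂ = ŵ R[ε].+ r̂
    ẑ = q̂ R[ε].+ r̂
    ĉ = ẑ R[ε].* ŵ
    -- The Leibniz rule gives `(z + w) * c`, and `z + w = q + r + w = p + q`.
    ĉ₁ : ĉ 1 ≈ (p + q) * c
    ĉ₁ = begin
      ĉ 1                         ≈⟨ *-at1 ẑ ŵ ⟩
      (q + r) * c + (c + 0#) * w  ≈⟨ solve 4 (λ w r q c → (q :+ r) :* c :+ (c :+ con (+ 0)) :* w
                                       := ((w :+ r) :+ q) :* c) refl w r q c ⟩
      (w + r + q) * c             ≈⟨ *-congʳ (+-congʳ p≈) ⟨
      (p + q) * c                 ∎
    module PI = Insertion.PeakInsertion R p q c p̂ q̂ ĉ (sym p≈) (+-identityʳ c) refl refl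
                  (trans (*-at0 ẑ ŵ) (trans (*-congʳ (sym z≈)) (sym c≈))) ĉ₁
    module DI = Insertion.DescentInsertion R z w ẑ ŵ (sym z≈) (trans (+-identityʳ c) c≈) refl c≈
    E-suc : ∀ k → E z w (suc k) ≈ w * E z w k + ε.E ẑ ŵ k 1
    E-suc k = ∑𝔖-insertions k w _ _ (λ π∈ → DI.∑-insertions-desWeight _ (∈𝔖⇒All< k π∈))

H≈transform-E : ∀ n (R : CommutativeRing a ℓ) →
  let open CommutativeRing R; open GeneratingFunctions R; open BinomialTransform R in
  ∀ {p q c z w r} → p ≈ w + r → z ≈ q + r → c ≈ z * w → H p q c n ≈ transform r (E z w) n
H≈transform-E zero R p≈ z≈ c≈ =
  -- Both sides are left unsimplified: the list sum over the empty permutation, and its transform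
  -- with a single term.
  solve 0 (1+0 := (con (+ 1) :* 1+0 :+ con (+ 0)) :+ con (+ 0)) refl
  where
  open CommutativeRing R using (refl)
  open IntegerSolver R
  1+0 : Polynomial 0
  1+0 = con (+ 1) :+ con (+ 0)
H≈transform-E (suc n) R p≈ z≈ c≈ =
  Recurrences.H≈transform-E-suc R n (H≈transform-E n (DualNumbers.R[ε] R)) p≈ z≈ c≈ (H≈transform-E n R p≈ z≈ c≈)

-- From weights to left peaks, descents and the first identity.

interiorPeaks-descent : ∀ {x y} π → (y <ᵇ x) ≡ true → interiorPeaks (x ∷ y ∷ π) ≡ interiorPeaks (y ∷ π)
interiorPeaks-descent         []      y<ᵇx = ≡.refl
interiorPeaks-descent {x} {y} (z ∷ π) y<ᵇx
  rewrite <⇒>ᵇ≡false (ℕ.<ᵇ⇒< y x (Equivalence.from T-≡ y<ᵇx)) = ≡.refl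

-- A letter reached by an ascent is a peak exactly when a descent follows, which is how `lpk` treats
-- a first letter.
interiorPeaks-ascent : ∀ {x y} π → (x <ᵇ y) ≡ true → interiorPeaks (x ∷ y ∷ π) ≡ lpk (y ∷ π)
interiorPeaks-ascent []      x<ᵇy = ≡.refl
interiorPeaks-ascent (z ∷ π) x<ᵇy rewrite x<ᵇy = ≡.refl

interiorPeaks-plateau : ∀ {x y} π → (x <ᵇ y) ≡ false → interiorPeaks (x ∷ y ∷ π) ≡ interiorPeaks (y ∷ π)
interiorPeaks-plateau []      x≮ᵇy = ≡.refl
interiorPeaks-plateau (z ∷ π) x≮ᵇy rewrite x≮ᵇy = ≡.refl

module Specialisation (R : CommutativeRing a ℓ) where
  open Eulerian R
  open Exp commutativeSemiring using (^-congʳ)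
  open Mult semiring using (×-congʳ)
  open Sum semiring using (sum-cong-≋)
  open SetoidReasoning setoid
  open ListSum R
  open GeneratingFunctions R
  open BinomialTransform R
  open IntegerSolver R

  module _ {p q c y t : Carrier} (pt≈q : p * t ≈ q) (pqy≈c : p * (q * y) ≈ c) where
    open Weights.Peaks R p q c

    -- Each letter takes one factor `p`. A descent turns `p * t` into `q`; a left peak and the
    -- letter after it turn `p * (p * t * y)` into `c`. In `rise≈` the exponent is one higher
    -- because the factor of `a` itself is still pending.
    fall≈ : ∀ a π → p ^ length π * (y ^ interiorPeaks (a ∷ π) * t ^ des (a ∷ π)) ≈ fall a π
    rise≈ : ∀ a π → p ^ suc (length π) * (y ^ lpk (a ∷ π) * t ^ des (a ∷ π)) ≈ rise a π
    fall≈ a [] = trans (*-identityˡ _) (*-identityˡ _)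
    fall≈ a (b ∷ π) with b <ᵇ a in b<ᵇa | a <ᵇ b in a<ᵇb
    ... | true | _ = begin
      p * p ^ length π * (y ^ interiorPeaks (a ∷ b ∷ π) * (t * t ^ des (b ∷ π)))
        ≡⟨ ≡.cong (λ i → p * p ^ length π * (y ^ i * (t * t ^ des (b ∷ π)))) (interiorPeaks-descent π b<ᵇa) ⟩
      p * p ^ length π * (y ^ interiorPeaks (b ∷ π) * (t * t ^ des (b ∷ π)))
        ≈⟨ solve 5 (λ p t l i d → p :* l :* (i :* (t :* d)) := (p :* t) :* (l :* (i :* d)))
             refl p t (p ^ length π) (y ^ interiorPeaks (b ∷ π)) (t ^ des (b ∷ π)) ⟩
      p * t * (p ^ length π * (y ^ interiorPeaks (b ∷ π) * t ^ des (b ∷ π)))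
        ≈⟨ *-cong pt≈q (fall≈ b π) ⟩
      q * fall b π ∎
    ... | false | true = begin
      p ^ suc (length π) * (y ^ interiorPeaks (a ∷ b ∷ π) * t ^ des (b ∷ π))
        ≡⟨ ≡.cong (λ i → p ^ suc (length π) * (y ^ i * t ^ des (b ∷ π))) (interiorPeaks-ascent π a<ᵇb) ⟩
      p ^ suc (length π) * (y ^ lpk (b ∷ π) * t ^ des (b ∷ π))
        ≈⟨ rise≈ b π ⟩
      rise b π ∎
    ... | false | false = begin
      p * p ^ length π * (y ^ interiorPeaks (a ∷ b ∷ π) * t ^ des (b ∷ π))
        ≡⟨ ≡.cong (λ i → p * p ^ length π * (y ^ i * t ^ des (b ∷ π))) (interiorPeaks-plateau π a<ᵇb) ⟩
      p * p ^ length π * (y ^ interiorPeaks (b ∷ π) * t ^ des (b ∷ π))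
        ≈⟨ *-assoc _ _ _ ⟩
      p * (p ^ length π * (y ^ interiorPeaks (b ∷ π) * t ^ des (b ∷ π)))
        ≈⟨ *-congˡ (fall≈ b π) ⟩
      p * fall b π ∎
    rise≈ a [] = begin
      p * 1# * (1# * 1#)  ≈⟨ solve 1 (λ p → p :* con (+ 1) :* (con (+ 1) :* con (+ 1)) := p) refl p ⟩
      p                   ∎
    -- Naming `fall≈ a (b ∷ π)` in the same `with` lets its type reduce along with `b <ᵇ a`, so
    -- without a descent it already speaks of `step false`.
    rise≈ a (b ∷ π) with b <ᵇ a in b<ᵇa | fall≈ a (b ∷ π)
    ... | true | _ = begin
      p * (p * p ^ length π) * (y * y ^ interiorPeaks (a ∷ b ∷ π) * (t * t ^ des (b ∷ π)))
        ≡⟨ ≡.cong (λ i → p * (p * p ^ length π) * (y * y ^ i * (t * t ^ des (b ∷ π))))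
             (interiorPeaks-descent π b<ᵇa) ⟩
      p * (p * p ^ length π) * (y * y ^ interiorPeaks (b ∷ π) * (t * t ^ des (b ∷ π)))
        ≈⟨ solve 6 (λ p t y l i d → p :* (p :* l) :* (y :* i :* (t :* d))
               := (p :* ((p :* t) :* y)) :* (l :* (i :* d)))
             refl p t y (p ^ length π) (y ^ interiorPeaks (b ∷ π)) (t ^ des (b ∷ π)) ⟩
      p * (p * t * y) * (p ^ length π * (y ^ interiorPeaks (b ∷ π) * t ^ des (b ∷ π)))
        ≈⟨ *-cong (trans (*-congˡ (*-congʳ pt≈q)) pqy≈c) (fall≈ b π) ⟩
      c * fall b π ∎
    ... | false | fall≈′ = begin
      p * p ^ suc (length π) * (y ^ interiorPeaks (a ∷ b ∷ π) * t ^ des (b ∷ π))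
        ≈⟨ *-assoc _ _ _ ⟩
      p * (p ^ suc (length π) * (y ^ interiorPeaks (a ∷ b ∷ π) * t ^ des (b ∷ π)))
        ≈⟨ *-congˡ fall≈′ ⟩
      p * step false (a <ᵇ b) b π ∎

    P≈H : ∀ n → p ^ n * P n y t ≈ H p q c n
    P≈H zero = solve 0 (con (+ 1) :* con (+ 1) := con (+ 1) :+ con (+ 0)) refl
    P≈H n@(suc _) = trans (sym (∑-*ˡ (p ^ n) (λ π → y ^ lpk π * t ^ des π) (𝔖 n)))
      (∑-cong (𝔖 n) λ {π} π∈ → trans (*-congʳ (^-congʳ p (≡.sym (∈𝔖⇒length n π∈)))) (weight≈ π))
      where
      weight≈ : ∀ π → p ^ length π * (y ^ lpk π * t ^ des π) ≈ peakWeight π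
      weight≈ []      = trans (*-identityˡ _) (*-identityˡ _)
      weight≈ (b ∷ π) = rise≈ b π

  module _ (z t : Carrier) where
    open Weights.Descents R z (z * t)

    steps≈ : ∀ a π → z ^ length π * t ^ des (a ∷ π) ≈ steps a π
    steps≈ a [] = *-identityˡ _
    steps≈ a (b ∷ π) with b <ᵇ a
    ... | true = begin
      z * z ^ length π * (t * t ^ des (b ∷ π))
        ≈⟨ solve 4 (λ z t l d → z :* l :* (t :* d) := z :* t :* (l :* d))
             refl z t (z ^ length π) (t ^ des (b ∷ π)) ⟩
      z * t * (z ^ length π * t ^ des (b ∷ π))
        ≈⟨ *-congˡ (steps≈ b π) ⟩
      z * t * steps b π ∎
    ... | false = trans (*-assoc _ _ _) (*-congˡ (steps≈ b π))

    -- With `w = z * t` every letter takes one `z`, and the first letter and each descent also take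
    -- a `t`.
    A≈E : ∀ n → z ^ n * A n t ≈ E z (z * t) n
    A≈E zero = solve 0 (con (+ 1) :* con (+ 1) := con (+ 1) :+ con (+ 0)) refl
    A≈E n@(suc _) = trans (sym (∑-*ˡ (z ^ n) (λ π → t ^ suc (des π)) (𝔖 n)))
      (∑-cong (𝔖 n) λ {π} π∈ → weight≈ π (∈𝔖⇒length n π∈))
      where
      weight≈ : ∀ π → length π ≡ n → z ^ n * t ^ suc (des π) ≈ desWeight π
      weight≈ (b ∷ π) ≡.refl = begin
        z * z ^ length π * (t * t ^ des (b ∷ π))
          ≈⟨ solve 4 (λ z t l d → z :* l :* (t :* d) := z :* t :* (l :* d))
               refl z t (z ^ length π) (t ^ des (b ∷ π)) ⟩
        z * t * (z ^ length π * t ^ des (b ∷ π))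
          ≈⟨ *-congˡ (steps≈ b π) ⟩
        z * t * steps b π ∎

  -- `T` and `Y` enter through their defining equations, cleared of denominators, so the identity
  -- holds in every commutative ring. It serves rational functions in `y`, `t` and power series at
  -- `u`, `v` alike.
  eulerian-transform : ∀ {y t Y T} →
    (1# + y * t) * T ≈ y + t → (1# + y * t) * ((y + t) * Y) ≈ (1# + y) ^ 2 * t → ∀ n →
    ∑[ k ≤ n ] ((n C toℕ k) · ((1# + y) ^ toℕ k * (1# - t) ^ (n ∸ toℕ k) * A (toℕ k) t))
      ≈ (1# + y * t) ^ n * P n Y T
  eulerian-transform {y} {t} {Y} {T} pT≈q pqY≈c n = begin
    ∑[ k ≤ n ] ((n C toℕ k) · (z ^ toℕ k * r ^ (n ∸ toℕ k) * A (toℕ k) t))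
      ≈⟨ sum-cong-≋ {suc n} (λ k → ×-congʳ (n C toℕ k) (summand≈ (toℕ k))) ⟩
    transform r (E z (z * t)) n
      ≈⟨ H≈transform-E n R
           (solve 2 (λ y t → con (+ 1) :+ y :* t := (con (+ 1) :+ y) :* t :+ (con (+ 1) :- t)) refl y t)
           (solve 2 (λ y t → con (+ 1) :+ y := y :+ t :+ (con (+ 1) :- t)) refl y t)
           (solve 2 (λ z t → z :* (z :* con (+ 1)) :* t := z :* (z :* t)) refl z t) ⟨
    H (1# + y * t) (y + t) (z ^ 2 * t) n
      ≈⟨ P≈H pT≈q pqY≈c n ⟨
    (1# + y * t) ^ n * P n Y T ∎
    where
    z = 1# + y
    r = 1# - t
    summand≈ : ∀ k → z ^ k * r ^ (n ∸ k) * A k t ≈ r ^ (n ∸ k) * E z (z * t) k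
    summand≈ k = begin
      z ^ k * r ^ (n ∸ k) * A k t
        ≈⟨ solve 3 (λ x y z → x :* y :* z := y :* (x :* z)) refl (z ^ k) (r ^ (n ∸ k)) (A k t) ⟩
      r ^ (n ∸ k) * (z ^ k * A k t)
        ≈⟨ *-congˡ (A≈E z t k) ⟩
      r ^ (n ∸ k) * E z (z * t) k ∎

-- Contractions and inverses in power series rings.

module FixedPoints (R : CommutativeRing a ℓ) where
  private
    module R = CommutativeRing R
    module S = CommutativeRing (PowerSeries.commutativeRing R)
  open PowerSeries R using (Series; _+_; -_; _*_; 0ₛ; 1ₛ; pointwise; at)
  open Sum R.semiring using (sum-cong-≋)

  Agree : ℕ → Series → Series → Set ℓ
  Agree n f g = ∀ {m} → m < n → f m R.≈ g m

  agree-* : ∀ {n f f′ g g′} → Agree n f f′ → Agree n g g′ → Agree n (f * g) (f′ * g′)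
  agree-* f≈ g≈ {m} m<n = sum-cong-≋ {suc m} λ i →
    R.*-cong (f≈ (ℕ.≤-<-trans (toℕ≤pred[n] i) m<n)) (g≈ (ℕ.≤-<-trans (ℕ.m∸n≤m m (toℕ i)) m<n))

  -- As `d 0` is 0, the coefficient of `d * f` in degree `m` involves `f` only below degree `m`.
  agree-*-suc : ∀ {n} d {f g} → d 0 R.≈ R.0# → Agree n f g → Agree (suc n) (d * f) (d * g)
  agree-*-suc d {f} {g} d₀≈0 f≈g {m} (s≤s m≤n) = sum-cong-≋ {suc m} term≈
    where
    d₀*≈0 : ∀ b → d 0 R.* b R.≈ R.0#
    d₀*≈0 b = R.trans (R.*-congʳ d₀≈0) (R.zeroˡ b)
    term≈ : ∀ (i : Fin (suc m)) → d (toℕ i) R.* f (m ∸ toℕ i) R.≈ d (toℕ i) R.* g (m ∸ toℕ i)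
    term≈ Fin.zero    = R.trans (d₀*≈0 (f m)) (R.sym (d₀*≈0 (g m)))
    term≈ (Fin.suc i) =
      R.*-congˡ (f≈g (ℕ.<-≤-trans (ℕ.∸-monoʳ-< (s≤s ℕ.z≤n) (toℕ<n i)) m≤n))

  module _ (F : Series → Series) (contractive : ∀ {n f g} → Agree n f g → Agree (suc n) (F f) (F g)) where
    private
      approx : ℕ → Series
      approx zero    = 0ₛ
      approx (suc n) = F (approx n)

      approx-suc : ∀ n → Agree n (approx (suc n)) (approx n)
      approx-suc (suc n) = contractive (approx-suc n)

      approx-stable : ∀ n {m} → m < n → approx n m R.≈ approx (suc m) m
      approx-stable (suc n) {m} m<1+n with ℕ.m<1+n⇒m<n∨m≡n m<1+n
      ... | inj₁ m<n    = R.trans (approx-suc n m<n) (approx-stable n m<n)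
      ... | inj₂ ≡.refl = R.refl

    -- The coefficient in degree `n` is final from iterate `suc n` on, so the limit is read off
    -- diagonally.
    fix : Series
    fix n = approx (suc n) n

    fix-fixed : F fix S.≈ fix
    fix-fixed = pointwise λ n →
      contractive (λ m<n → R.sym (approx-stable n m<n)) (ℕ.n<1+n n)

  -- An inverse of `f` is a fixed point of `g ↦ 1 - (f - 1) g`, a contraction since `f - 1` has
  -- constant term 0.
  unit⇒invertible : ∀ f → f 0 R.≈ R.1# → ∃[ g ] f * g S.≈ 1ₛ
  unit⇒invertible f f₀≈1 = g , (begin
    f * g                      ≈⟨ solve 2 (λ f g → f :* g := g :+ (f :- con (+ 1)) :* g) S.refl f g ⟩
    g + (f S.- 1ₛ) * g         ≈⟨ S.+-congʳ (fix-fixed F contractive) ⟨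
    F g + (f S.- 1ₛ) * g       ≈⟨ solve 2 (λ f g →
                                    con (+ 1) :- (f :- con (+ 1)) :* g :+ (f :- con (+ 1)) :* g
                                      := con (+ 1)) S.refl f g ⟩
    1ₛ                         ∎)
    where
    open IntegerSolver (PowerSeries.commutativeRing R)
    open SetoidReasoning S.setoid
    F : Series → Series
    F g = 1ₛ S.- (f S.- 1ₛ) * g
    contractive : ∀ {n g g′} → Agree n g g′ → Agree (suc n) (F g) (F g′)
    contractive g≈g′ m<n = R.+-congˡ (R.-‿cong
      (agree-*-suc (f S.- 1ₛ) (R.trans (R.+-congʳ f₀≈1) (R.-‿inverseʳ R.1#)) g≈g′ m<n))
    g = fix F contractive

-- Parametrisation of the square root, `u` and `v`.

module Parametrisation (R : CommutativeRing a ℓ) (y t g : CommutativeRing.Carrier R) where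
  open Eulerian R
  open Exp commutativeSemiring using (^-congˡ)
  open SetoidReasoning setoid
  open IntegerSolver R

  -- The equation `g = t h k` is the quadratic `a g² + b g - t = 0` with `a = t y (1 - y)` and
  -- `b = 1 + t - 2 y t`. Its discriminant is `(1 + t)² - 4 y t`, with square root `√Δ = 2 a g + b`.
  -- Polynomial formulas for `u` and `v` avoid dividing by their denominators.
  h k √Δ u v : Carrier
  h  = 1# - (1# - y) * g
  k  = 1# + y * g
  √Δ = 1# + t * (1# - 2 · (y * h))
  u  = t * ((1# - y) * k ^ 2)
  v  = t * (y * h ^ 2)

  module _ (g≈thk : g ≈ t * (h * k)) where
    private
      thk-g = t * (h * k) - g

      -- An identity modulo g = t h k becomes a polynomial one, with cofactor c.
      absorb : ∀ {x} b c → x ≈ b + c * thk-g → x ≈ b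
      absorb {x} b c x≈ = begin
        x              ≈⟨ x≈ ⟩
        b + c * thk-g  ≈⟨ +-congˡ (*-congˡ (trans (+-congʳ (sym g≈thk)) (-‿inverseʳ g))) ⟩
        b + c * 0#     ≈⟨ +-congˡ (zeroʳ c) ⟩
        b + 0#         ≈⟨ +-identityʳ b ⟩
        b              ∎

      one : ∀ {n} → Polynomial n
      one = con (+ 1)
      hₚ kₚ : ∀ {n} → Polynomial n → Polynomial n → Polynomial n
      hₚ y g = one :- (one :- y) :* g
      kₚ y g = one :+ y :* g
      uₚ vₚ √Δₚ eₚ : ∀ {n} → Polynomial n → Polynomial n → Polynomial n → Polynomial n
      uₚ y t g = t :* ((one :- y) :* kₚ y g :^ 2)
      vₚ y t g = t :* (y :* hₚ y g :^ 2)
      √Δₚ y t g = one :+ t :* (one :- 2 :× (y :* hₚ y g))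
      eₚ y t g = t :* (hₚ y g :* kₚ y g) :- g

    √Δ² : √Δ ^ 2 ≈ (1# + t) ^ 2 - 4 · (y * t)
    -- The cofactor is `- 4 a`, as `(2 a g + b)² - (b² + 4 a t) = 4 a (a g² + b g -
    -- t)` and the last bracket is `g - t h k`.
    √Δ² = absorb _ (- (4 · (y * t * (1# - y)))) (solve 3 (λ y t g →
      √Δₚ y t g :^ 2 :=
        ((one :+ t) :^ 2 :- 4 :× (y :* t)) :+ (:- (4 :× (y :* t :* (one :- y)))) :* eₚ y t g)
      refl y t g)

    u-numerator : 2 · ((1# - y) * t) * u ≈ (1# + t ^ 2 - 2 · (y * t)) - (1# - t) * √Δ
    u-numerator = absorb _ (- (2 · (t * y * (1# - y)))) (solve 3 (λ y t g →
      2 :× ((one :- y) :* t) :* uₚ y t g :=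
        ((one :+ t :^ 2 :- 2 :× (y :* t)) :- (one :- t) :* √Δₚ y t g)
          :+ (:- (2 :× (t :* y :* (one :- y)))) :* eₚ y t g)
      refl y t g)

    v-numerator : 2 · (y * t) * v ≈ ((1# + t) ^ 2 - 2 · (y * t)) - (1# + t) * √Δ
    v-numerator = absorb _ (- (2 · (t * y * (1# - y)))) (solve 3 (λ y t g →
      2 :× (y :* t) :* vₚ y t g :=
        (((one :+ t) :^ 2 :- 2 :× (y :* t)) :- (one :+ t) :* √Δₚ y t g)
          :+ (:- (2 :× (t :* y :* (one :- y)))) :* eₚ y t g)
      refl y t g)

    1+uv≈ : 1# + u * v ≈ 1# + y * (1# - y) * g ^ 2
    1+uv≈ = +-congˡ (begin
      u * v                             ≈⟨ solve 4 (λ y t h k → t :* ((one :- y) :* k :^ 2) :* (t :* (y :* h :^ 2))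
                                             := y :* (one :- y) :* (t :* (h :* k)) :^ 2) refl y t h k ⟩
      y * (1# - y) * (t * (h * k)) ^ 2  ≈⟨ *-congˡ (^-congˡ 2 g≈thk) ⟨
      y * (1# - y) * g ^ 2              ∎)

    [1+uv]t≈u+v : (1# + u * v) * t ≈ u + v
    [1+uv]t≈u+v = trans (*-congʳ 1+uv≈) (solve 3 (λ y t g →
      (one :+ y :* (one :- y) :* g :^ 2) :* t := uₚ y t g :+ vₚ y t g) refl y t g)

    -- Used squared: multiplied by `t y` it gives `(1 + u v)² t y = (1 + u)² v`, since `v = t y h²`.
    1+uv≈[1+u]h : 1# + u * v ≈ (1# + u) * h
    1+uv≈[1+u]h = begin
      1# + u * v                              ≈⟨ 1+uv≈ ⟩
      1# + y * (1# - y) * g ^ 2               ≈⟨ solve 2 (λ y g → one :+ y :* (one :- y) :* g :^ 2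
                                                   := hₚ y g :+ (one :- y) :* kₚ y g :* g) refl y g ⟩
      h + (1# - y) * k * g                    ≈⟨ +-congˡ (*-congˡ g≈thk) ⟩
      h + (1# - y) * k * (t * (h * k))        ≈⟨ solve 4 (λ y t h k → h :+ (one :- y) :* k :* (t :* (h :* k))
                                                   := (one :+ t :* ((one :- y) :* k :^ 2)) :* h) refl y t h k ⟩
      (1# + u) * h                            ∎

    [1+uv][u+v]y≈[1+u]²v : (1# + u * v) * ((u + v) * y) ≈ (1# + u) ^ 2 * v
    [1+uv][u+v]y≈[1+u]²v = begin
      (1# + u * v) * ((u + v) * y)              ≈⟨ *-congˡ (*-congʳ [1+uv]t≈u+v) ⟨
      (1# + u * v) * ((1# + u * v) * t * y)     ≈⟨ *-cong 1+uv≈[1+u]h (*-congʳ (*-congʳ 1+uv≈[1+u]h)) ⟩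
      (1# + u) * h * ((1# + u) * h * t * y)     ≈⟨ solve 4 (λ p h t y → p :* h :* (p :* h :* t :* y)
                                                     := p :^ 2 :* (t :* (y :* h :^ 2))) refl (1# + u) h t y ⟩
      (1# + u) ^ 2 * v                          ∎

-- Solving the first identity for `P`.

module Inversion (R : CommutativeRing a ℓ) where
  open Eulerian R
  open Exp commutativeSemiring using (^-distrib-*; ^-congˡ)
  open SetoidReasoning setoid

  1^n≈1 : ∀ n → 1# ^ n ≈ 1#
  1^n≈1 zero    = refl
  1^n≈1 (suc n) = trans (*-identityˡ _) (1^n≈1 n)

  ^-inverse : ∀ {x w} → x * w ≈ 1# → ∀ n → x ^ n * w ^ n ≈ 1#
  ^-inverse {x} {w} xw≈1 n = begin
    x ^ n * w ^ n  ≈⟨ ^-distrib-* x w n ⟨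
    (x * w) ^ n    ≈⟨ ^-congˡ n xw≈1 ⟩
    1# ^ n         ≈⟨ 1^n≈1 n ⟩
    1#             ∎

  ^-inverse-quotient : 1# ≉ 0# → ∀ {x w} → x * w ≈ 1# → ∀ n → w ^ n ≐ 1# ÷ (x ^ n)
  ^-inverse-quotient 1≉0 {x} {w} xw≈1 n = xⁿ≉0 , ^-inverse xw≈1 n
    where
    xⁿ≉0 : x ^ n ≉ 0#
    xⁿ≉0 xⁿ≈0 = 1≉0 (begin
      1#             ≈⟨ ^-inverse xw≈1 n ⟨
      x ^ n * w ^ n  ≈⟨ *-congʳ xⁿ≈0 ⟩
      0# * w ^ n     ≈⟨ zeroˡ _ ⟩
      0#             ∎)

  -- This is the first identity at the arguments `u`, `v`, where `y` and `t` are the substituted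
  -- quotients, multiplied by an inverse of `(1 + u v)ⁿ`.
  eulerian-transform-inverse : ∀ {u v y t w} → (1# + u * v) * w ≈ 1# →
    (1# + u * v) * t ≈ u + v → (1# + u * v) * ((u + v) * y) ≈ (1# + u) ^ 2 * v → ∀ n →
    P n y t ≈ w ^ n * (∑[ k ≤ n ] ((n C toℕ k) · ((1# + u) ^ toℕ k * (1# - v) ^ (n ∸ toℕ k) * A (toℕ k) v)))
  eulerian-transform-inverse {u} {v} {y} {t} {w} pw≈1 pt≈u+v pqy≈c n = begin
    P n y t                                ≈⟨ *-identityˡ _ ⟨
    1# * P n y t                           ≈⟨ *-congʳ (trans (*-comm _ _) (^-inverse pw≈1 n)) ⟨
    w ^ n * (1# + u * v) ^ n * P n y t     ≈⟨ *-assoc _ _ _ ⟩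
    w ^ n * ((1# + u * v) ^ n * P n y t)   ≈⟨ *-congˡ (Specialisation.eulerian-transform R pt≈u+v pqy≈c n) ⟨
    w ^ n * (∑[ k ≤ n ] ((n C toℕ k) · ((1# + u) ^ toℕ k * (1# - v) ^ (n ∸ toℕ k) * A (toℕ k) v))) ∎

-- The series `g` over the polynomials in `y`.

module SeriesSolution where
  open Eulerian ℚ[y]⟦t⟧
  open FormalSeries
  open FixedPoints ℚ[y]
  private
    module R = CommutativeRing ℚ[y]

    coefficient : ℕ → ℕ → Carrier → ℚ
    coefficient i j f = Poly[ℚ].coeff (f j) i

    coefficient-cong : ∀ i j {f f′} → f ≈ f′ → coefficient i j f ≡ coefficient i j f′
    coefficient-cong i j f≈f′ = Poly[ℚ].coeff-≈ (Series[ℚ[y]].at f≈f′ j) .PowerSeries.at i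

  growth : Carrier → Carrier
  growth g = t * ((1# - (1# - y) * g) * (1# + y * g))

  -- The outer factor `t` has constant term 0 and gains the degree; the inner factors keep the
  -- agreement.
  growth-contractive : ∀ {n g g′} → Agree n g g′ → Agree (suc n) (growth g) (growth g′)
  growth-contractive {n} {g} {g′} g≈g′ = agree-*-suc t R.refl
    (agree-* {f = 1# - (1# - y) * g} {f′ = 1# - (1# - y) * g′} {g = 1# + y * g} {g′ = 1# + y * g′}
      (λ {m} m<n → R.+-congˡ (R.-‿cong (agree-constant-* (1# - y) m<n)))
      (λ {m} m<n → R.+-congˡ (agree-constant-* y m<n)))
    where
    agree-constant-* : ∀ b → Agree n (b * g) (b * g′)
    agree-constant-* b = agree-* {f = b} {f′ = b} {g = g} {g′ = g′} (λ _ → R.refl) g≈g′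

  g : Carrier
  g = fix growth growth-contractive

  open Parametrisation ℚ[y]⟦t⟧ y t g

  g≈thk : g ≈ t * (h * k)
  g≈thk = sym (fix-fixed growth growth-contractive)

  t*-at0 : ∀ f → (t * f) 0 R.≈ R.0#
  t*-at0 f = R.trans (R.+-identityʳ _) (R.zeroˡ _)

  √Δ₀ : √Δ 0 R.≈ R.1#
  √Δ₀ = R.trans (R.+-congˡ (t*-at0 (1# - 2 · (y * h)))) (R.+-identityʳ _)

  u-denominator≉0 : 2 · ((1# - y) * t) ≉ 0#
  -- The coefficient of `y⁰ t¹` is 2.
  u-denominator≉0 e = contradiction (coefficient-cong 0 1 e) λ ()

  v-denominator≉0 : 2 · (y * t) ≉ 0#
  -- The coefficient of `y¹ t¹` is 2.
  v-denominator≉0 e = contradiction (coefficient-cong 1 1 e) λ ()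

  -- The constant term of `u` is 0 because `u` is a multiple of `t`. This makes `1 + u v`
  -- invertible.
  1+uv-at0 : (1# + u * v) 0 R.≈ R.1#
  1+uv-at0 = R.trans (R.+-congˡ (R.trans (R.+-identityʳ _)
    (R.trans (R.*-congʳ (t*-at0 ((1# - y) * k ^ 2))) (R.zeroˡ _)))) (R.+-identityʳ _)

-- Defining equations of the two substituted quotients.

module FractionIdentities (R : CommutativeRing a ℓ) (dom : IsIntegralDomain R)
  (y t : CommutativeRing.Carrier R) where
  private
    module R = CommutativeRing R
    module F = CommutativeRing (Fractions.commutativeRing R dom)
  open R using (0#; 1#; _≉_; _+_; _*_)
  open Exp R.commutativeSemiring using (_^_)
  open Exp F.commutativeSemiring using () renaming (_^_ to _^F_)
  open IsIntegralDomain dom using (*-nonzero)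
  open Fractions R dom using (_/_⟨_⟩; ι; crossEqual)
  open IntegerSolver R

  -- The solver terms below spell out numerators and denominators unsimplified.
  module _ (y+t≉0 : y + t ≉ 0#) (1+yt≉0 : 1# + y * t ≉ 0#) where
    [1+yt]T≈y+t : (F.1# F.+ ι y F.* ι t) F.* ((y + t) / (1# + y * t) ⟨ 1+yt≉0 ⟩) F.≈ ι y F.+ ι t
    [1+yt]T≈y+t = crossEqual (solve 2 (λ y t →
      let one = con (+ 1); p = one :+ y :* t; q = y :+ t in
      ((one :* (one :* one) :+ (y :* t) :* one) :* q) :* (one :* one) :=
      (y :* one :+ t :* one) :* ((one :* (one :* one)) :* p)) R.refl y t)

    [1+yt][y+t]Y≈[1+y]²t :
      (F.1# F.+ ι y F.* ι t) F.* ((ι y F.+ ι t) F.*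
        (((1# + y) ^ 2 * t) / ((y + t) * (1# + y * t)) ⟨ *-nonzero y+t≉0 1+yt≉0 ⟩))
        F.≈ (F.1# F.+ ι y) ^F 2 F.* ι t
    [1+yt][y+t]Y≈[1+y]²t = crossEqual (solve 2 (λ y t →
      let one = con (+ 1); p = one :+ y :* t; q = y :+ t; z = one :* one :+ y :* one in
      ((one :* (one :* one) :+ (y :* t) :* one) :* ((y :* one :+ t :* one) :* ((one :+ y) :^ 2 :* t)))
        :* (((one :* one) :* ((one :* one) :* one)) :* one) :=
      ((z :* (z :* one)) :* t) :* ((one :* (one :* one)) :* ((one :* one) :* (q :* p)))) R.refl y t)

theorem4p7 :
  (let open Eulerian ℚ⟨y,t⟩
       open RationalFunctions in
    (n : ℕ) →
      ∑[ k ≤ n ] ((n C toℕ k) · ((1# + y) ^ toℕ k * (1# - t) ^ (n ∸ toℕ k) * A (toℕ k) t))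
        ≈ (1# + y * t) ^ n * P n [1+y]²t/[y+t][1+yt] [y+t]/[1+yt])
  ×
  (let open Eulerian ℚ[y]⟦t⟧
       open FormalSeries in
    ∃[ √Δ ] ∃[ u ] ∃[ v ]
      (CommutativeRing._≈_ ℚ[y] (√Δ 0) (CommutativeRing.1# ℚ[y]))
      × (√Δ ^ 2 ≈ (1# + t) ^ 2 - 4 · (y * t))
      × (u ≐ (1# + t ^ 2 - 2 · (y * t)) - (1# - t) * √Δ ÷ (2 · ((1# - y) * t)))
      × (v ≐ ((1# + t) ^ 2 - 2 · (y * t)) - (1# + t) * √Δ ÷ (2 · (y * t)))
      × ((n : ℕ) → ∃[ w ]
           (w ≐ 1# ÷ ((1# + u * v) ^ n))
           × (P n y t ≈ w * (∑[ k ≤ n ]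
                ((n C toℕ k) · ((1# + u) ^ toℕ k * (1# - v) ^ (n ∸ toℕ k) * A (toℕ k) v))))))
theorem4p7 =
  Specialisation.eulerian-transform ℚ⟨y,t⟩
    ([1+yt]T≈y+t y+t≉0 1+yt≉0) ([1+yt][y+t]Y≈[1+y]²t y+t≉0 1+yt≉0) ,
  √Δ , u , v , √Δ₀ , √Δ² g≈thk ,
  (u-denominator≉0 , u-numerator g≈thk) ,
  (v-denominator≉0 , v-numerator g≈thk) ,
  -- The powers of one inverse of `1 + u v` are the required quotients.
  λ n → let w , [1+uv]w≈1 = unit⇒invertible (1# + u * v) 1+uv-at0 in
    w ^ n , ^-inverse-quotient 1≉0 [1+uv]w≈1 n ,
    eulerian-transform-inverse [1+uv]w≈1 ([1+uv]t≈u+v g≈thk) ([1+uv][u+v]y≈[1+u]²v g≈thk) n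
  where
  open RationalFunctions using (yₚ; tₚ; y+t≉0; 1+yt≉0)
  open FractionIdentities ℚ[y,t] (Poly[ℚ[y]].isIntegralDomain ℚ[y]-isIntegralDomain) yₚ tₚ
  open Eulerian ℚ[y]⟦t⟧ using (1#; _+_; _*_; _^_)
  open IsIntegralDomain (Series[ℚ[y]].isIntegralDomain ℚ[y]-isIntegralDomain) using (1≉0)
  open FixedPoints ℚ[y] using (unit⇒invertible)
  open Inversion ℚ[y]⟦t⟧
  open SeriesSolution
  open Parametrisation ℚ[y]⟦t⟧ FormalSeries.y FormalSeries.t g
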